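{- There is an absolute constant $c>0$ such that every regular $C_5$-free graph $G$ with $m$ edges satisfies $\mathrm{sp}(G)\ge c\, m^{6/7}$.
   Context: All graphs are finite and simple. $C_5$ is the cycle with $5$ edges; $C_5$-free means containing no subgraph isomorphic to $C_5$. $\mathrm{mc}(G)$ denotes the maximum number of edges crossing a partition of $V(G)$ into two parts, and $\mathrm{sp}(G)=\mathrm{mc}(G)-e(G)/2$. -}

module Defs where

open import Data.Nat using (ℕ; zero; suc; _+_; _*_; _<ᵇ_; _⊔_)
open import Data.Bool using (Bool; true; false; _∧_; not; if_then_else_)
open import Data.Fin using (Fin; toℕ; #_)
open import Data.List using (List; []; _∷_; map; allFin; _++_; foldr)
open import Data.Nat.ListAction using (sum)
open import Data.Vec using (Vec; lookup)
import Data.Vec as Vec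
open import Relation.Binary.PropositionalEquality using (_≡_; _≢_)
open import Data.Product using (∃; _×_)
open import Relation.Nullary using (¬_)

record Graph : Set where
  field
    n     : ℕ
    adj   : Fin n → Fin n → Bool
    sym   : ∀ u v → adj u v ≡ adj v u
    irref : ∀ v → adj v v ≡ false
open Graph public

_≠ᵇ_ : Bool → Bool → Bool
true  ≠ᵇ b = not b
false ≠ᵇ b = b

countPairs : (k : ℕ) → (Fin k → Fin k → Bool) → ℕ
countPairs k P =
  sum (map (λ u → sum (map (λ v → if (toℕ u <ᵇ toℕ v) ∧ P u v then 1 else 0)
                             (allFin k)))
           (allFin k))

e : Graph → ℕ
e G = countPairs (n G) (adj G)

deg : (G : Graph) → Fin (n G) → ℕ
deg G v = sum (map (λ u → if adj G v u then 1 else 0) (allFin (n G)))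

Regular : Graph → Set
Regular G = ∃ λ d → ∀ v → deg G v ≡ d

ContainsC5 : Graph → Set
ContainsC5 G = ∃ λ (v : Fin 5 → Fin (n G)) →
  (∀ i j → i ≢ j → v i ≢ v j) ×
  ( adj G (v (# 0)) (v (# 1)) ≡ true
  × adj G (v (# 1)) (v (# 2)) ≡ true
  × adj G (v (# 2)) (v (# 3)) ≡ true
  × adj G (v (# 3)) (v (# 4)) ≡ true
  × adj G (v (# 4)) (v (# 0)) ≡ true)

C5Free : Graph → Set
C5Free G = ¬ ContainsC5 G

-- all 2^k bipartitions of Fin k, encoded as Bool vectors (side of each vertex)
allParts : (k : ℕ) → List (Vec Bool k)
allParts zero    = Vec.[] ∷ []
allParts (suc k) = map (true Vec.∷_) (allParts k) ++ map (false Vec.∷_) (allParts k)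

cut : (G : Graph) → Vec Bool (n G) → ℕ
cut G S = countPairs (n G) (λ u v → adj G u v ∧ (lookup S u ≠ᵇ lookup S v))

mc : Graph → ℕ
mc G = foldr (λ S acc → cut G S ⊔ acc) 0 (allParts (n G))

{-# OPTIONS --safe #-}
module Submission where

-- Rounding. Let s_v be vectors with |s_v|² ≤ 1/8. For a uniformly random choice of signs ±, one for
-- each coordinate w, put y_v = Im ∏_w (1 - s_{v,w}² ± i s_{v,w}). These are numbers in [-1, 1], and
-- 𝔼 y_u y_v = ½ (∏(cc′ + ss′) - ∏(cc′ - ss′)) with c = 1 - s², which is up to constants the inner
-- product of s_u and s_v, even when positive and negative contributions are weighted differently.
-- The cut form is multilinear, so it attains at some signs a value at least as good; hence twice the
-- surplus is at least a constant times -∑_{u∼v} ⟨s_u, s_v⟩.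
--
-- Two choices of vectors. Let G be d-regular on n vertices, N₂(v) the second neighbourhood and
-- ρ_v ≈ |N₂(v)|^{-1/2}. As G has no C5, the edges inside neighbourhoods and second neighbourhoods
-- are few. So s_v = a·1_v - (b/√d)·1_{N(v)} + c ρ_v·1_{N₂(v)} gives surplus ≳ d^{3/2} K with
-- K = ∑_v ρ_v, and s_v = ρ_v·1_{N₂(v)} minus its mean gives surplus ≳ H/n with
-- H = ∑_{u∼v} 1/(ρ_u ρ_v), up to a multiple of the first bound. The AM-GM inequality yields
-- H K² ≳ n³ d, and K ≳ n/d because |N₂(v)| ≤ d²; together surplus⁷ ≳ K⁶ d⁹ · H/n ≳ (n d)⁶.

open import Defs hiding (sym)
open import Algebra.Bundles using (CommutativeRing)
import Algebra.Properties.Semiring.Sum as SemiringSum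
open import Data.Bool using (Bool; true; false; _∧_; not; if_then_else_)
import Data.Bool.Properties as Bool
open import Data.Empty using (⊥; ⊥-elim)
open import Data.Fin using (Fin; zero; suc; toℕ; _≟_)
open import Data.Fin.Properties using (any?; toℕ-injective)
import Data.Integer as ℤ
import Data.Integer.Properties as ℤ
open import Data.List as List using (List; []; _∷_)
open import Data.List.Membership.Propositional using (_∈_)
open import Data.List.Membership.Propositional.Properties using (∈-++⁺ˡ; ∈-++⁺ʳ; ∈-map⁺)
open import Data.List.Properties using (map-tabulate)
open import Data.List.Relation.Unary.All as All using (All)
open import Data.List.Relation.Unary.Any using (here; there)
open import Data.Maybe using (just; nothing)
open import Data.Nat as ℕ using (ℕ; zero; suc; NonZero; _<ᵇ_; _^_; _∸_)
import Data.Nat.ListAction as ListAction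
import Data.Nat.Properties as ℕ
open import Data.Product using (Σ; ∃; _×_; _,_; proj₁; proj₂)
open import Data.Rational using (ℚ; 0ℚ; 1ℚ; ½; _+_; _*_; _-_; -_; _≤_; _<_; _/_; 1/_; nonNegative; positive; toℚᵘ)
open import Data.Rational.Properties renaming (_≟_ to _≟ℚ_)
import Data.Rational.Unnormalised as ℚᵘ
import Data.Rational.Unnormalised.Properties as ℚᵘ
open import Data.Sum using (_⊎_; inj₁; inj₂; [_,_]′)
open import Data.Vec as Vec using (Vec; lookup)
import Data.Vec.Relation.Unary.All as VecAll
import Data.Vec.Relation.Unary.AllPairs as AllPairs
open import Data.Vec.Relation.Unary.Unique.Propositional using (Unique)
open import Data.Vec.Relation.Unary.Unique.Propositional.Properties using (lookup-injective)
open import Level using (0ℓ)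
open import Relation.Binary.Definitions using (tri<; tri≈; tri>)
open import Relation.Binary.PropositionalEquality using (_≡_; _≢_; refl; sym; trans; cong; cong₂; subst; subst₂)
open import Relation.Nullary using (Dec; ¬_; contradiction; yes; no; does; ¬?; _×-dec_)
open import Relation.Nullary.Decidable using (dec-true; dec-false)
open import Tactic.RingSolver using (solve; solve-∀)
open import Tactic.RingSolver.Core.AlmostCommutativeRing using (AlmostCommutativeRing; fromCommutativeRing)

-- Everything is done over ℚ, so the Gaussian vectors and the arcsine of hyperplane rounding are
-- avoided: s itself serves as the sine and 1 - s² as the cosine. The price is a multiplicative
-- error, by which a positive product along an edge may count four times as much as a negative one.
-- So positive products along edges must be few, and this is where the absence of C5 enters: on
-- average, adjacent vertices have few common neighbours and second neighbourhoods with a small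
-- intersection. Once the mean is removed, small intersections become negative correlation.
--
-- The exponent comes from a balance. If every second neighbourhood has about d² vertices, the first
-- bound is about n √d and the second about d³; they meet at n = d^{5/2}, where both equal (n
-- d)^{6/7}. Unequal second neighbourhoods are handled by keeping K free and eliminating it at the
-- end. Small degrees are treated separately, since second neighbourhoods may then be empty, as in a
-- disjoint union of copies of K₄.

ℚ-ring : AlmostCommutativeRing 0ℓ 0ℓ
ℚ-ring = fromCommutativeRing +-*-commutativeRing λ x → isZero x
  where
  isZero : ∀ x → _
  isZero x with 0ℚ ≟ℚ x
  ... | yes 0≡x = just 0≡x
  ... | no  _   = nothing

2ℚ 4ℚ 8ℚ 16ℚ 32ℚ 512ℚ ¼ ⅛ : ℚ
2ℚ = ℤ.+ 2 / 1
4ℚ = ℤ.+ 4 / 1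
8ℚ = ℤ.+ 8 / 1
16ℚ = ℤ.+ 16 / 1
32ℚ = ℤ.+ 32 / 1
512ℚ = ℤ.+ 512 / 1
¼ = ℤ.+ 1 / 4
⅛ = ℤ.+ 1 / 8

-- Ordered arithmetic and finite sums over ℚ

infixl 6 _⊕_
infixl 7 _⊗_

_⊕_ : ∀ {x y} → 0ℚ ≤ x → 0ℚ ≤ y → 0ℚ ≤ x + y
0≤x ⊕ 0≤y = +-mono-≤ 0≤x 0≤y

_⊗_ : ∀ {x y} → 0ℚ ≤ x → 0ℚ ≤ y → 0ℚ ≤ x * y
_⊗_ {x} {y} 0≤x 0≤y =
  subst (_≤ x * y) (*-zeroʳ x) (*-monoˡ-≤-nonNeg x {{nonNegative 0≤x}} 0≤y)

≤⇒0≤ : ∀ {x y} → x ≤ y → 0ℚ ≤ y - x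
≤⇒0≤ {x} {y} x≤y = subst (_≤ y - x) (+-inverseʳ x) (+-monoˡ-≤ (- x) x≤y)

-- The pattern of nearly every estimate below: hypotheses become nonnegative differences through
-- `≤⇒0≤`, the target difference is written as a combination of them built with `⊕` and `⊗`, and the
-- ring solver checks the identity. Unexplained numerals in such proofs are coefficients of this
-- certificate.
0≤⇒≤ : ∀ {x y z} → 0ℚ ≤ z → y - x ≡ z → x ≤ y
0≤⇒≤ {x} {y} 0≤z refl =
  subst₂ _≤_ (+-identityˡ x) (restore x y) (+-monoˡ-≤ x 0≤z)
  where
  restore : ∀ x y → y - x + x ≡ y
  restore = solve-∀ ℚ-ring

square≥0 : ∀ x → 0ℚ ≤ x * x
square≥0 x with ≤-total 0ℚ x
... | inj₁ 0≤x = 0≤x ⊗ 0≤x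
... | inj₂ x≤0 = subst (0ℚ ≤_) (neg-square x) (≤⇒0≤ x≤0 ⊗ ≤⇒0≤ x≤0)
  where
  neg-square : ∀ x → (0ℚ - x) * (0ℚ - x) ≡ x * x
  neg-square = solve-∀ ℚ-ring

*-mono-≤ : ∀ {a b c d} → 0ℚ ≤ a → 0ℚ ≤ d → a ≤ b → c ≤ d → a * c ≤ b * d
*-mono-≤ {a} {b} {c} {d} 0≤a 0≤d a≤b c≤d =
  0≤⇒≤ (0≤a ⊗ ≤⇒0≤ c≤d ⊕ ≤⇒0≤ a≤b ⊗ 0≤d) (solve (a ∷ b ∷ c ∷ d ∷ []) ℚ-ring)

open SemiringSum (CommutativeRing.semiring +-*-commutativeRing)
  using (sum; sum-syntax; sum-cong-≗; ∑-distrib-+; ∑-comm; *-distribˡ-sum; *-distribʳ-sum; sum-replicate-zero)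

sum-mono : ∀ {n} {f g : Fin n → ℚ} → (∀ i → f i ≤ g i) → sum f ≤ sum g
sum-mono {zero}  f≤g = ≤-refl
sum-mono {suc n} f≤g = +-mono-≤ (f≤g zero) (sum-mono (λ i → f≤g (suc i)))

sum-nonneg : ∀ {n} {f : Fin n → ℚ} → (∀ i → 0ℚ ≤ f i) → 0ℚ ≤ sum f
sum-nonneg {zero}  0≤f = ≤-refl
sum-nonneg {suc n} 0≤f = 0≤f zero ⊕ sum-nonneg (λ i → 0≤f (suc i))

term≤sum : ∀ {n} {f : Fin n → ℚ} → (∀ i → 0ℚ ≤ f i) → ∀ i → f i ≤ sum f
term≤sum {suc n} {f} 0≤f zero =
  subst (_≤ sum f) (+-identityʳ _) (+-monoʳ-≤ (f zero) (sum-nonneg (λ i → 0≤f (suc i))))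
term≤sum {suc n} {f} 0≤f (suc i) =
  subst (_≤ sum f) (+-identityˡ _) (+-mono-≤ (0≤f zero) (term≤sum (λ i → 0≤f (suc i)) i))

sum-const-* : ∀ {n} x (f : Fin n → ℚ) → sum (λ i → x * f i) ≡ x * sum f
sum-const-* x f = sym (*-distribˡ-sum x f)

ι : ℕ → ℚ
ι zero    = 0ℚ
ι (suc n) = 1ℚ + ι n

ι-+ : ∀ m n → ι (m ℕ.+ n) ≡ ι m + ι n
ι-+ zero    n = sym (+-identityˡ _)
ι-+ (suc m) n = trans (cong (1ℚ +_) (ι-+ m n)) (sym (+-assoc 1ℚ (ι m) (ι n)))

ι-* : ∀ m n → ι (m ℕ.* n) ≡ ι m * ι n
ι-* zero    n = sym (*-zeroˡ (ι n))
ι-* (suc m) n = trans (ι-+ n (m ℕ.* n)) (trans (cong (ι n +_) (ι-* m n)) (helper (ι m) (ι n)))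
  where
  helper : ∀ x y → y + x * y ≡ (1ℚ + x) * y
  helper = solve-∀ ℚ-ring

0≤1 : 0ℚ ≤ 1ℚ
0≤1 = nonNegative⁻¹ 1ℚ

ι-nonneg : ∀ n → 0ℚ ≤ ι n
ι-nonneg zero    = ≤-refl
ι-nonneg (suc n) = 0≤1 ⊕ ι-nonneg n

ι-mono : ∀ {m n} → m ℕ.≤ n → ι m ≤ ι n
ι-mono {n = n} ℕ.z≤n = ι-nonneg n
ι-mono (ℕ.s≤s m≤n) = +-monoʳ-≤ 1ℚ (ι-mono m≤n)

sum-const : ∀ n x → ∑[ i < n ] x ≡ ι n * x
sum-const zero    x = sym (*-zeroˡ x)
sum-const (suc n) x = trans (cong (λ z → x + z) (sum-const n x)) (helper (ι n) x)
  where
  helper : ∀ k y → y + k * y ≡ (1ℚ + k) * y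
  helper = solve-∀ ℚ-ring

-- Trigonometric rounding

∑² : ∀ {n} → (Fin n → Fin n → ℚ) → ℚ
∑² {n} f = ∑[ u < n ] ∑[ v < n ] f u v

∑²-cong : ∀ {n} {f g : Fin n → Fin n → ℚ} → (∀ u v → f u v ≡ g u v) → ∑² f ≡ ∑² g
∑²-cong f≡g = sum-cong-≗ (λ u → sum-cong-≗ (f≡g u))

∑²-mono : ∀ {n} {f g : Fin n → Fin n → ℚ} → (∀ u v → f u v ≤ g u v) → ∑² f ≤ ∑² g
∑²-mono f≤g = sum-mono (λ u → sum-mono (f≤g u))

∑²-+ : ∀ {n} (f g : Fin n → Fin n → ℚ) → ∑² (λ u v → f u v + g u v) ≡ ∑² f + ∑² g
∑²-+ {n} f g = trans (sum-cong-≗ (λ u → ∑-distrib-+ (f u) (g u)))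
                 (∑-distrib-+ (λ u → sum (f u)) (λ u → sum (g u)))

∑²-* : ∀ {n} x (f : Fin n → Fin n → ℚ) → ∑² (λ u v → x * f u v) ≡ x * ∑² f
∑²-* x f = trans (sum-cong-≗ (λ u → sum-const-* x (f u))) (sum-const-* x (λ u → sum (f u)))

sumL : ∀ {A : Set} → (A → ℚ) → List A → ℚ
sumL f []       = 0ℚ
sumL f (x ∷ xs) = f x + sumL f xs

sumL-nonneg : ∀ {A : Set} {f : A → ℚ} → (∀ x → 0ℚ ≤ f x) → ∀ xs → 0ℚ ≤ sumL f xs
sumL-nonneg 0≤f []       = ≤-refl
sumL-nonneg 0≤f (x ∷ xs) = 0≤f x ⊕ sumL-nonneg 0≤f xs

core : ℚ → ℚ → ℚ
core a b = (1ℚ - a * a) * (1ℚ - b * b)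

-- With a as sin α and 1 - a² in place of cos α, these are the addition formulas for cos (α - β) and
-- cos (α + β); the superscript is the sign between the angles.
cos⁻ cos⁺ : ℚ → ℚ → ℚ
cos⁻ a b = core a b + a * b
cos⁺ a b = core a b - a * b

module _ (a b : ℚ) (a²≤1 : a * a ≤ 1ℚ) (b²≤1 : b * b ≤ 1ℚ) where

  core-lower : 1ℚ - (a * a + b * b) ≤ (1ℚ - a * a) * (1ℚ - b * b)
  core-lower = 0≤⇒≤ (square≥0 (a * b)) (solve (a ∷ b ∷ []) ℚ-ring)

  core≤1 : (1ℚ - a * a) * (1ℚ - b * b) ≤ 1ℚ
  core≤1 = 0≤⇒≤ (square≥0 a ⊗ ≤⇒0≤ b²≤1 ⊕ square≥0 b) (solve (a ∷ b ∷ []) ℚ-ring)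

  private
    0≤½ : 0ℚ ≤ ½
    0≤½ = nonNegative⁻¹ ½

  cos⁻≤1 : (1ℚ - a * a) * (1ℚ - b * b) + a * b ≤ 1ℚ
  cos⁻≤1 = 0≤⇒≤ (0≤½ ⊗ (square≥0 (a - b) ⊕ square≥0 a ⊗ ≤⇒0≤ b²≤1 ⊕ square≥0 b ⊗ ≤⇒0≤ a²≤1))
                (solve (a ∷ b ∷ []) ℚ-ring)

  cos⁺≤1 : (1ℚ - a * a) * (1ℚ - b * b) - a * b ≤ 1ℚ
  cos⁺≤1 = 0≤⇒≤ (0≤½ ⊗ (square≥0 (a + b) ⊕ square≥0 a ⊗ ≤⇒0≤ b²≤1 ⊕ square≥0 b ⊗ ≤⇒0≤ a²≤1))
                (solve (a ∷ b ∷ []) ℚ-ring)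

  cos⁻-lower : 1ℚ - 2ℚ * (a * a + b * b) ≤ (1ℚ - a * a) * (1ℚ - b * b) + a * b
  cos⁻-lower = 0≤⇒≤ (0≤½ ⊗ (square≥0 (a + b) ⊕ square≥0 a ⊕ square≥0 b) ⊕ square≥0 (a * b))
                    (solve (a ∷ b ∷ []) ℚ-ring)

  cos⁺-lower : 1ℚ - 2ℚ * (a * a + b * b) ≤ (1ℚ - a * a) * (1ℚ - b * b) - a * b
  cos⁺-lower = 0≤⇒≤ (0≤½ ⊗ (square≥0 (a - b) ⊕ square≥0 a ⊕ square≥0 b) ⊕ square≥0 (a * b))
                    (solve (a ∷ b ∷ []) ℚ-ring)

module _ {n : ℕ} where

  -- The two parts need not be the positive and negative part of `val`: both may be nonzero at the
  -- same vertex, and the asymmetric `gain` depends on them separately.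
  record Coordinate : Set where
    field
      pos neg : Fin n → ℚ
      0≤pos   : ∀ v → 0ℚ ≤ pos v
      0≤neg   : ∀ v → 0ℚ ≤ neg v

    val : Fin n → ℚ
    val v = pos v - neg v

  open Coordinate

  Small : Coordinate → Set
  Small s = ∀ v → val s v * val s v ≤ 1ℚ

  ∏⁻ ∏⁺ : List Coordinate → Fin n → Fin n → ℚ
  ∏⁻ []      u v = 1ℚ
  ∏⁻ (s ∷ L) u v = cos⁻ (val s u) (val s v) * ∏⁻ L u v
  ∏⁺ []      u v = 1ℚ
  ∏⁺ (s ∷ L) u v = cos⁺ (val s u) (val s v) * ∏⁺ L u v

  spread : Fin n → Fin n → List Coordinate → ℚ
  spread u v = sumL (λ s → val s u * val s u + val s v * val s v)

  spread-nonneg : ∀ u v L → 0ℚ ≤ spread u v L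
  spread-nonneg u v = sumL-nonneg (λ s → square≥0 (val s u) ⊕ square≥0 (val s v))

  energy : (W : Fin n → Fin n → ℚ) → List Coordinate → (p q : Fin n → ℚ) → Fin n → Fin n → ℚ
  energy W L p q u v =
    W u v * ((p u * p v - q u * q v) * ∏⁺ L u v - (p u * p v + q u * q v) * ∏⁻ L u v)

  module _ {W : Fin n → Fin n → ℚ} {M : ℚ}
           (bound : ∀ (y : Fin n → ℚ) → (∀ v → y v * y v ≤ 1ℚ) → ∑² (λ u v → W u v * (- (y u * y v))) ≤ M) where

    -- The energy is the expectation of -2 times the form at the imaginary part of
    -- (p + i q) ∏ (1 - s² ± i s), with independent signs ±, one for each coordinate s.
    energy≤ : ∀ L → All Small L → ∀ p q → (∀ v → p v * p v + q v * q v ≤ 1ℚ) →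
              ∑² (energy W L p q) ≤ M + M
    energy≤ [] All.[] p q unit =
      subst (_≤ M + M) (trans (sym (∑²-+ form form)) (∑²-cong λ u v → double (W u v) (p u) (p v) (q u) (q v)))
        (+-mono-≤ q-bound q-bound)
      where
      form : Fin n → Fin n → ℚ
      form u v = W u v * (- (q u * q v))
      q-bound : ∑² form ≤ M
      q-bound = bound q (λ v → ≤-trans (0≤⇒≤ (square≥0 (p v)) (drop (p v) (q v))) (unit v))
        where
        drop : ∀ a b → a * a + b * b - b * b ≡ a * a
        drop = solve-∀ ℚ-ring
      double : ∀ w p p′ q q′ → w * (- (q * q′)) + w * (- (q * q′)) ≡
               w * ((p * p′ - q * q′) * 1ℚ - (p * p′ + q * q′) * 1ℚ)
      double = solve-∀ ℚ-ring
    energy≤ (s ∷ L) (small All.∷ smalls) p q unit =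
      halve (trans (sym (∑²-+ (energy W (s ∷ L) p q) (energy W (s ∷ L) p q)))
              (trans (∑²-cong λ u v → average (W u v) (p u) (p v) (q u) (q v) (val s u) (val s v) (c u) (c v) (∏⁺ L u v) (∏⁻ L u v))
                (∑²-+ (energy W L p₊ q₊) (energy W L p₋ q₋))))
        (energy≤ L smalls p₊ q₊ λ v → ≤-trans (rotate (p v) (q v) (val s v) (small v)) (unit v))
        (energy≤ L smalls p₋ q₋ λ v → ≤-trans (subst (_≤ _) (flip (p v) (q v) (val s v)) (rotate (p v) (- q v) (val s v) (small v)))
          (subst (_≤ 1ℚ) (flip′ (p v) (q v)) (unit v)))
      where
      c p₊ q₊ p₋ q₋ : Fin n → ℚ
      c v = 1ℚ - val s v * val s v
      p₊ v = p v * c v - q v * val s v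
      q₊ v = p v * val s v + q v * c v
      p₋ v = p v * c v + q v * val s v
      q₋ v = q v * c v - p v * val s v
      halve : ∀ {x y z} → x + x ≡ y + z → y ≤ M + M → z ≤ M + M → x ≤ M + M
      halve {x} {y} {z} e y≤ z≤ = 0≤⇒≤ (nonNegative⁻¹ ½ ⊗ (≤⇒0≤ y≤ ⊕ ≤⇒0≤ z≤))
        (trans (split M x) (trans (cong (λ t → ½ * (M + M + (M + M) - t)) e) (merge M y z)))
        where
        split : ∀ m x → m + m - x ≡ ½ * (m + m + (m + m) - (x + x))
        split = solve-∀ ℚ-ring
        merge : ∀ m y z → ½ * (m + m + (m + m) - (y + z)) ≡ ½ * (m + m - y + (m + m - z))
        merge = solve-∀ ℚ-ring
      -- The squared modulus of 1 - s² + i s is 1 - s² (1 - s²), so multiplication by it stays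
      -- inside the unit disc.
      rotate : ∀ p q s → s * s ≤ 1ℚ →
               (p * (1ℚ - s * s) - q * s) * (p * (1ℚ - s * s) - q * s) +
               (p * s + q * (1ℚ - s * s)) * (p * s + q * (1ℚ - s * s)) ≤ p * p + q * q
      rotate p q s s²≤1 = 0≤⇒≤ ((square≥0 p ⊕ square≥0 q) ⊗ (square≥0 s ⊗ ≤⇒0≤ s²≤1))
        (solve (p ∷ q ∷ s ∷ []) ℚ-ring)
      flip : ∀ p q s → (p * (1ℚ - s * s) - - q * s) * (p * (1ℚ - s * s) - - q * s) +
               (p * s + - q * (1ℚ - s * s)) * (p * s + - q * (1ℚ - s * s)) ≡
             (p * (1ℚ - s * s) + q * s) * (p * (1ℚ - s * s) + q * s) +
               (q * (1ℚ - s * s) - p * s) * (q * (1ℚ - s * s) - p * s)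
      flip = solve-∀ ℚ-ring
      flip′ : ∀ p q → p * p + q * q ≡ p * p + - q * - q
      flip′ = solve-∀ ℚ-ring
      -- Conjugating the factor reverses the terms containing exactly one of s and s′; they cancel
      -- between the two signs and leave the factors of `cos⁺` and `cos⁻`.
      average : ∀ w p p′ q q′ s s′ c c′ x y →
        w * ((p * p′ - q * q′) * ((c * c′ - s * s′) * x) - (p * p′ + q * q′) * ((c * c′ + s * s′) * y)) +
        w * ((p * p′ - q * q′) * ((c * c′ - s * s′) * x) - (p * p′ + q * q′) * ((c * c′ + s * s′) * y)) ≡
        w * (((p * c - q * s) * (p′ * c′ - q′ * s′) - (p * s + q * c) * (p′ * s′ + q′ * c′)) * x -
             ((p * c - q * s) * (p′ * c′ - q′ * s′) + (p * s + q * c) * (p′ * s′ + q′ * c′)) * y) +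
        w * (((p * c + q * s) * (p′ * c′ + q′ * s′) - (q * c - p * s) * (q′ * c′ - p′ * s′)) * x -
             ((p * c + q * s) * (p′ * c′ + q′ * s′) + (q * c - p * s) * (q′ * c′ - p′ * s′)) * y)
      average = solve-∀ ℚ-ring

  -- The Weierstrass product inequality, stated abstractly so that it serves both `∏⁺` and `∏⁻`. The
  -- bound ¼ keeps the product of the tail nonnegative, as is needed to multiply upper bounds.
  ∏-bounds : (f : Coordinate → ℚ) (δ : Coordinate → ℚ) → ∀ {P : Coordinate → Set} → (∀ s → 0ℚ ≤ δ s) →
             (∀ {s} → P s → 1ℚ - 2ℚ * δ s ≤ f s × f s ≤ 1ℚ) →
             (∏ : List Coordinate → ℚ) → ∏ [] ≡ 1ℚ → (∀ s L → ∏ (s ∷ L) ≡ f s * ∏ L) →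
             ∀ L → All P L → sumL δ L ≤ ¼ →
             1ℚ - 2ℚ * sumL δ L ≤ ∏ L × ∏ L ≤ 1ℚ
  ∏-bounds f δ 0≤δ f-bounds ∏ ∏[] ∏∷ [] All.[] _ rewrite ∏[] = ≤-refl , ≤-refl
  ∏-bounds f δ 0≤δ f-bounds ∏ ∏[] ∏∷ (s ∷ L) (Ps All.∷ PL) Σ≤¼ rewrite ∏∷ s L =
    lower (δ s) (sumL δ L) (f s) (∏ L) f≥ f≤ ∏≥ ∏≤ , upper (δ s) (sumL δ L) (f s) (∏ L) (0≤δ s) 0≤ΣL Σ≤¼ f≤ ∏≥ ∏≤
    where
    0≤ΣL = sumL-nonneg 0≤δ L
    f≥ = proj₁ (f-bounds Ps)
    f≤ = proj₂ (f-bounds Ps)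
    ih = ∏-bounds f δ 0≤δ f-bounds ∏ ∏[] ∏∷ L PL
           (≤-trans (0≤⇒≤ (0≤δ s) (drop (δ s) (sumL δ L))) Σ≤¼)
      where
      drop : ∀ x y → x + y - y ≡ x
      drop = solve-∀ ℚ-ring
    ∏≥ = proj₁ ih
    ∏≤ = proj₂ ih
    lower : ∀ d σ x y → 1ℚ - 2ℚ * d ≤ x → x ≤ 1ℚ → 1ℚ - 2ℚ * σ ≤ y → y ≤ 1ℚ →
            1ℚ - 2ℚ * (d + σ) ≤ x * y
    lower d σ x y x≥ x≤ y≥ y≤ = 0≤⇒≤ (≤⇒0≤ x≥ ⊕ ≤⇒0≤ y≥ ⊕ ≤⇒0≤ x≤ ⊗ ≤⇒0≤ y≤)
      (solve (d ∷ σ ∷ x ∷ y ∷ []) ℚ-ring)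
    upper : ∀ d σ x y → 0ℚ ≤ d → 0ℚ ≤ σ → d + σ ≤ ¼ → x ≤ 1ℚ → 1ℚ - 2ℚ * σ ≤ y → y ≤ 1ℚ → x * y ≤ 1ℚ
    upper d σ x y 0≤d 0≤σ small x≤ y≥ y≤ = 0≤⇒≤ (≤⇒0≤ x≤ ⊗ 0≤y ⊕ ≤⇒0≤ y≤) (solve (x ∷ y ∷ []) ℚ-ring)
      where
      0≤1-2σ : 0ℚ ≤ 1ℚ - 2ℚ * σ
      0≤1-2σ = 0≤⇒≤ (nonNegative⁻¹ ½ ⊕ nonNegative⁻¹ 2ℚ ⊗ (≤⇒0≤ small ⊕ 0≤d)) (solve (d ∷ σ ∷ []) ℚ-ring)
      0≤y : 0ℚ ≤ y
      0≤y = ≤-trans 0≤1-2σ y≥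

  module _ (u v : Fin n) (G : Coordinate → ℚ) where

    -- The factor κ collects the cosines of the coordinates already processed.
    gap : ∀ L → All Small L → (∀ s → G s ≤ - (val s u * val s v)) → (∀ s → G s ≤ - (4ℚ * (val s u * val s v))) →
          ∀ κ → κ ≤ 1ℚ → ℤ.+ 3 / 4 ≤ κ - spread u v L →
          ½ * sumL G L ≤ κ * (∏⁺ L u v - ∏⁻ L u v)
    gap [] All.[] G≤ G≤′ κ κ≤1 κ≥ = ≤-reflexive (trivial κ)
      where
      trivial : ∀ κ → ½ * 0ℚ ≡ κ * (1ℚ - 1ℚ)
      trivial = solve-∀ ℚ-ring
    gap (s ∷ L) (small All.∷ smalls) G≤ G≤′ κ κ≤1 κ≥ =
      combine (G s) (sumL G L) κ K τ A B (weighted τ (G s) φ (G≤ s) (G≤′ s) φ≥ φ≤) ih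
      where
      a = val s u
      b = val s v
      K = core a b
      τ = a * b
      d = a * a + b * b
      ς = spread u v L
      A = ∏⁺ L u v
      B = ∏⁻ L u v
      φ = κ * (A + B)
      0≤d : 0ℚ ≤ d
      0≤d = square≥0 a ⊕ square≥0 b
      0≤ς : 0ℚ ≤ ς
      0≤ς = spread-nonneg u v L
      κ≥¾ : ∀ κ d ς → 0ℚ ≤ d → 0ℚ ≤ ς → ℤ.+ 3 / 4 ≤ κ - (d + ς) → ℤ.+ 3 / 4 ≤ κ
      κ≥¾ κ d ς 0≤d 0≤ς h = 0≤⇒≤ (≤⇒0≤ h ⊕ 0≤d ⊕ 0≤ς) (solve (κ ∷ d ∷ ς ∷ []) ℚ-ring)
      ς≤¼ : ∀ κ d ς → 0ℚ ≤ d → κ ≤ 1ℚ → ℤ.+ 3 / 4 ≤ κ - (d + ς) → ς ≤ ¼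
      ς≤¼ κ d ς 0≤d κ≤ h = 0≤⇒≤ (≤⇒0≤ h ⊕ 0≤d ⊕ ≤⇒0≤ κ≤) (solve (κ ∷ d ∷ ς ∷ []) ℚ-ring)
      ¾≤κ = κ≥¾ κ d ς 0≤d 0≤ς κ≥
      0≤κ : 0ℚ ≤ κ
      0≤κ = ≤-trans (nonNegative⁻¹ (ℤ.+ 3 / 4)) ¾≤κ
      ς-small = ς≤¼ κ d ς 0≤d κ≤1 κ≥
      δ : Coordinate → ℚ
      δ s = val s u * val s u + val s v * val s v
      0≤δ : ∀ s → 0ℚ ≤ δ s
      0≤δ s = square≥0 (val s u) ⊕ square≥0 (val s v)
      A-bounds = ∏-bounds (λ s → cos⁺ (val s u) (val s v)) δ 0≤δ
        (λ {s} sm → cos⁺-lower (val s u) (val s v) (sm u) (sm v) , cos⁺≤1 (val s u) (val s v) (sm u) (sm v)) (λ L → ∏⁺ L u v) refl (λ _ _ → refl) L smalls ς-small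
      B-bounds = ∏-bounds (λ s → cos⁻ (val s u) (val s v)) δ 0≤δ
        (λ {s} sm → cos⁻-lower (val s u) (val s v) (sm u) (sm v) , cos⁻≤1 (val s u) (val s v) (sm u) (sm v)) (λ L → ∏⁻ L u v) refl (λ _ _ → refl) L smalls ς-small
      ½≤ : ∀ ς x → ς ≤ ¼ → 1ℚ - 2ℚ * ς ≤ x → ½ ≤ x
      ½≤ ς x h h′ = 0≤⇒≤ (≤⇒0≤ h′ ⊕ nonNegative⁻¹ 2ℚ ⊗ ≤⇒0≤ h) (solve (ς ∷ x ∷ []) ℚ-ring)
      ½≤A = ½≤ ς A ς-small (proj₁ A-bounds)
      ½≤B = ½≤ ς B ς-small (proj₁ B-bounds)
      lower : ∀ κ A B → ℤ.+ 3 / 4 ≤ κ → ½ ≤ A → ½ ≤ B → ½ ≤ κ * (A + B)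
      lower κ A B κ≥ A≥ B≥ = 0≤⇒≤
        (nonNegative⁻¹ ¼ ⊕ ≤⇒0≤ κ≥ ⊕ (≤⇒0≤ κ≥ ⊕ nonNegative⁻¹ (ℤ.+ 3 / 4)) ⊗ (≤⇒0≤ A≥ ⊕ ≤⇒0≤ B≥))
        (solve (κ ∷ A ∷ B ∷ []) ℚ-ring)
      upper : ∀ κ A B → 0ℚ ≤ κ → κ ≤ 1ℚ → A ≤ 1ℚ → B ≤ 1ℚ → κ * (A + B) ≤ 2ℚ
      upper κ A B 0≤κ κ≤ A≤ B≤ = 0≤⇒≤
        (nonNegative⁻¹ 2ℚ ⊗ ≤⇒0≤ κ≤ ⊕ 0≤κ ⊗ (≤⇒0≤ A≤ ⊕ ≤⇒0≤ B≤))
        (solve (κ ∷ A ∷ B ∷ []) ℚ-ring)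
      φ≥ = lower κ A B ¾≤κ ½≤A ½≤B
      φ≤ = upper κ A B 0≤κ κ≤1 (proj₂ A-bounds) (proj₂ B-bounds)
      -- The true coefficient φ of -τ is only known to lie between ½ and 2. The pessimistic choice
      -- is 2 for positive τ and ½ for negative τ; their ratio is the 4 in `gain`.
      weighted : ∀ τ g φ → g ≤ - τ → g ≤ - (4ℚ * τ) → ½ ≤ φ → φ ≤ 2ℚ → ½ * g ≤ φ * (- τ)
      weighted τ g φ g≤ g≤′ φ≥ φ≤ with ≤-total 0ℚ τ
      ... | inj₁ 0≤τ = 0≤⇒≤ (≤⇒0≤ φ≤ ⊗ 0≤τ ⊕ nonNegative⁻¹ ½ ⊗ ≤⇒0≤ g≤′) (solve (τ ∷ g ∷ φ ∷ []) ℚ-ring)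
      ... | inj₂ τ≤0 = 0≤⇒≤ (≤⇒0≤ φ≥ ⊗ ≤⇒0≤ τ≤0 ⊕ nonNegative⁻¹ ½ ⊗ ≤⇒0≤ g≤) (solve (τ ∷ g ∷ φ ∷ []) ℚ-ring)
      -- Since κ ≤ 1, replacing κ by κ K loses at most d, which is exactly the amount by which the
      -- remaining spread drops.
      shrink : ∀ κ K d ς → 0ℚ ≤ κ → κ ≤ 1ℚ → 0ℚ ≤ d → 1ℚ - d ≤ K → ℤ.+ 3 / 4 ≤ κ - (d + ς) → ℤ.+ 3 / 4 ≤ κ * K - ς
      shrink κ K d ς 0≤κ κ≤ 0≤d K≥ h = 0≤⇒≤ (≤⇒0≤ h ⊕ 0≤κ ⊗ ≤⇒0≤ K≥ ⊕ ≤⇒0≤ κ≤ ⊗ 0≤d)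
        (solve (κ ∷ K ∷ d ∷ ς ∷ []) ℚ-ring)
      κK≤1 : ∀ κ K → 0ℚ ≤ κ → κ ≤ 1ℚ → K ≤ 1ℚ → κ * K ≤ 1ℚ
      κK≤1 κ K 0≤κ κ≤ K≤ = 0≤⇒≤ (≤⇒0≤ κ≤ ⊕ 0≤κ ⊗ ≤⇒0≤ K≤) (solve (κ ∷ K ∷ []) ℚ-ring)
      ih = gap L smalls G≤ G≤′ (κ * K) (κK≤1 κ K 0≤κ κ≤1 (core≤1 a b (small u) (small v)))
             (shrink κ K d ς 0≤κ κ≤1 0≤d (core-lower a b (small u) (small v)) κ≥)
      -- The difference of products telescopes as K (A - B) - τ (A + B): the second term belongs to
      -- the current coordinate, the first to the tail with κ K in place of κ.
      combine : ∀ g σ κ K τ A B → ½ * g ≤ κ * (A + B) * (- τ) → ½ * σ ≤ κ * K * (A - B) →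
                ½ * (g + σ) ≤ κ * ((K - τ) * A - (K + τ) * B)
      combine g σ κ K τ A B h h′ = 0≤⇒≤ (≤⇒0≤ h ⊕ ≤⇒0≤ h′)
        (solve (g ∷ σ ∷ κ ∷ K ∷ τ ∷ A ∷ B ∷ []) ℚ-ring)

  -- A common lower bound for -s_u s_v and -4 s_u s_v: positive products are penalised more than
  -- negative ones are rewarded, which absorbs the error terms of the rounding.
  gain : Coordinate → Fin n → Fin n → ℚ
  gain s u v = pos s u * neg s v + neg s u * pos s v - 4ℚ * (pos s u * pos s v + neg s u * neg s v)

  gain≤ : ∀ u v s → gain s u v ≤ - (val s u * val s v)
  gain≤ u v s = lemma (pos s u) (neg s u) (pos s v) (neg s v) (0≤pos s u) (0≤neg s u) (0≤pos s v) (0≤neg s v)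
    where
    lemma : ∀ p q p′ q′ → 0ℚ ≤ p → 0ℚ ≤ q → 0ℚ ≤ p′ → 0ℚ ≤ q′ →
            p * q′ + q * p′ - 4ℚ * (p * p′ + q * q′) ≤ - ((p - q) * (p′ - q′))
    lemma p q p′ q′ 0≤p 0≤q 0≤p′ 0≤q′ = 0≤⇒≤ (nonNegative⁻¹ (ℤ.+ 3 / 1) ⊗ (0≤p ⊗ 0≤p′ ⊕ 0≤q ⊗ 0≤q′))
      (solve (p ∷ q ∷ p′ ∷ q′ ∷ []) ℚ-ring)

  gain≤4 : ∀ u v s → gain s u v ≤ - (4ℚ * (val s u * val s v))
  gain≤4 u v s = lemma (pos s u) (neg s u) (pos s v) (neg s v) (0≤pos s u) (0≤neg s u) (0≤pos s v) (0≤neg s v)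
    where
    lemma : ∀ p q p′ q′ → 0ℚ ≤ p → 0ℚ ≤ q → 0ℚ ≤ p′ → 0ℚ ≤ q′ →
            p * q′ + q * p′ - 4ℚ * (p * p′ + q * q′) ≤ - (4ℚ * ((p - q) * (p′ - q′)))
    lemma p q p′ q′ 0≤p 0≤q 0≤p′ 0≤q′ = 0≤⇒≤ (nonNegative⁻¹ (ℤ.+ 3 / 1) ⊗ (0≤p ⊗ 0≤q′ ⊕ 0≤q ⊗ 0≤p′))
      (solve (p ∷ q ∷ p′ ∷ q′ ∷ []) ℚ-ring)

  norm : Fin n → Coordinate → ℚ
  norm v s = pos s v * pos s v + neg s v * neg s v

  0≤norm : ∀ v s → 0ℚ ≤ norm v s
  0≤norm v s = square≥0 (pos s v) ⊕ square≥0 (neg s v)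

  val²≤norm : ∀ v s → val s v * val s v ≤ norm v s
  val²≤norm v s = lemma (pos s v) (neg s v) (0≤pos s v) (0≤neg s v)
    where
    lemma : ∀ p q → 0ℚ ≤ p → 0ℚ ≤ q → (p - q) * (p - q) ≤ p * p + q * q
    lemma p q 0≤p 0≤q = 0≤⇒≤ (nonNegative⁻¹ 2ℚ ⊗ (0≤p ⊗ 0≤q)) (solve (p ∷ q ∷ []) ℚ-ring)

  norms⇒small : ∀ L → (∀ v → sumL (norm v) L ≤ ⅛) → All Small L
  norms⇒small []      norms = All.[]
  norms⇒small (s ∷ L) norms =
    (λ v → ≤-trans (val²≤norm v s) (≤-trans (head≤ v) (≤-trans (norms v) (≤ᵇ⇒≤ _)))) All.∷
    norms⇒small L (λ v → ≤-trans (tail≤ v) (norms v))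
    where
    head≤ : ∀ v → norm v s ≤ sumL (norm v) (s ∷ L)
    head≤ v = subst (_≤ sumL (norm v) (s ∷ L)) (+-identityʳ _) (+-monoʳ-≤ (norm v s) (sumL-nonneg (0≤norm v) L))
    tail≤ : ∀ v → sumL (norm v) L ≤ sumL (norm v) (s ∷ L)
    tail≤ v = subst (_≤ sumL (norm v) (s ∷ L)) (+-identityˡ _) (+-monoˡ-≤ (sumL (norm v) L) (0≤norm v s))

  spread≤norms : ∀ u v L → spread u v L ≤ sumL (norm u) L + sumL (norm v) L
  spread≤norms u v []      = ≤-refl
  spread≤norms u v (s ∷ L) = ≤-trans
    (+-mono-≤ (+-mono-≤ (val²≤norm u s) (val²≤norm v s)) (spread≤norms u v L))
    (≤-reflexive (exchange (norm u s) (norm v s) (sumL (norm u) L) (sumL (norm v) L)))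
    where
    exchange : ∀ a b c d → a + b + (c + d) ≡ a + c + (b + d)
    exchange = solve-∀ ℚ-ring

  -- At p = 1 and q = 0 the energy is the weighted difference of `∏⁺` and `∏⁻`, so `gap` applies
  -- with κ = 1; two norms of at most ⅛ leave its required ¾. The factor 4 combines the ½ of `gap`
  -- with the bound 2 M on the energy.
  rounding : ∀ {W : Fin n → Fin n → ℚ} {M : ℚ} → (∀ u v → 0ℚ ≤ W u v) →
             (∀ y → (∀ v → y v * y v ≤ 1ℚ) → ∑² (λ u v → W u v * (- (y u * y v))) ≤ M) →
             ∀ L → (∀ v → sumL (norm v) L ≤ ⅛) →
             ∑² (λ u v → W u v * sumL (λ s → gain s u v) L) ≤ 4ℚ * M
  rounding {W} {M} 0≤W bound L norms = double M (∑² (λ u v → W u v * gains u v))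
    (≤-trans (≤-reflexive (sym (∑²-* ½ (λ u v → W u v * gains u v))))
      (≤-trans (∑²-mono pointwise) (energy≤ {W = W} bound L smalls (λ _ → 1ℚ) (λ _ → 0ℚ) (λ _ → ≤-refl))))
    where
    smalls = norms⇒small L norms
    gains : Fin n → Fin n → ℚ
    gains u v = sumL (λ s → gain s u v) L
    spread≤¼ : ∀ u v → ℤ.+ 3 / 4 ≤ 1ℚ - spread u v L
    spread≤¼ u v = lemma (spread u v L) (sumL (norm u) L) (sumL (norm v) L) (spread≤norms u v L) (norms u) (norms v)
      where
      lemma : ∀ x a b → x ≤ a + b → a ≤ ⅛ → b ≤ ⅛ → ℤ.+ 3 / 4 ≤ 1ℚ - x
      lemma x a b x≤ a≤ b≤ = 0≤⇒≤ (≤⇒0≤ x≤ ⊕ ≤⇒0≤ a≤ ⊕ ≤⇒0≤ b≤) (solve (x ∷ a ∷ b ∷ []) ℚ-ring)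
    pointwise : ∀ u v → ½ * (W u v * gains u v) ≤ energy W L (λ _ → 1ℚ) (λ _ → 0ℚ) u v
    pointwise u v = lemma (W u v) (gains u v) (∏⁺ L u v) (∏⁻ L u v) (0≤W u v)
      (gap u v (λ s → gain s u v) L smalls (gain≤ u v) (gain≤4 u v) 1ℚ ≤-refl (spread≤¼ u v))
      where
      lemma : ∀ w g x y → 0ℚ ≤ w → ½ * g ≤ 1ℚ * (x - y) →
              ½ * (w * g) ≤ w * ((1ℚ * 1ℚ - 0ℚ * 0ℚ) * x - (1ℚ * 1ℚ + 0ℚ * 0ℚ) * y)
      lemma w g x y 0≤w h = 0≤⇒≤ (0≤w ⊗ ≤⇒0≤ h) (solve (w ∷ g ∷ x ∷ y ∷ []) ℚ-ring)
    double : ∀ m x → ½ * x ≤ m + m → x ≤ 4ℚ * m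
    double m x h = 0≤⇒≤ (nonNegative⁻¹ 2ℚ ⊗ ≤⇒0≤ h) (solve (m ∷ x ∷ []) ℚ-ring)

-- Cuts and quadratic forms

𝟙 : Bool → ℚ
𝟙 true  = 1ℚ
𝟙 false = 0ℚ

0≤𝟙 : ∀ b → 0ℚ ≤ 𝟙 b
0≤𝟙 true  = 0≤1
0≤𝟙 false = ≤-refl

sign : Bool → ℚ
sign true  = 1ℚ
sign false = - 1ℚ

-- The constant and linear parts are there for induction: fixing one variable turns its cross terms
-- into linear ones. A zero diagonal makes the form affine in each variable.
quadratic : ∀ {k} → ℚ → (Fin k → ℚ) → (Fin k → Fin k → ℚ) → (Fin k → ℚ) → ℚ
quadratic c l M y = c + sum (λ v → l v * y v) + ∑² (λ u v → M u v * (y u * y v))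

cross : ∀ {k} → (Fin (suc k) → Fin (suc k) → ℚ) → Fin k → ℚ
cross M v = M zero (suc v) + M (suc v) zero

quadratic-head : ∀ {k} c l (M : Fin (suc k) → Fin (suc k) → ℚ) → M zero zero ≡ 0ℚ → ∀ y →
  quadratic c l M y ≡
  quadratic (c + l zero * y zero) (λ v → l (suc v) + y zero * cross M v) (λ u v → M (suc u) (suc v)) (λ v → y (suc v))
quadratic-head {k} c l M M₀₀≡0 y = trans (cong₂ (λ m r → c + (l zero * y zero + sum lin) + (m * (y zero * y zero) + sum row + r)) M₀₀≡0
    (∑-distrib-+ col (λ u → ∑[ v < k ] inner u v)))
  (trans (rearrange c (l zero) (y zero) (sum lin) (sum row) (sum col) (∑² inner))
    (cong (λ t → c + l zero * y zero + t + ∑² inner)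
      (sym (trans (sum-cong-≗ (λ v → expand (l (suc v)) (y zero) (M zero (suc v)) (M (suc v) zero) (y (suc v))))
        (trans (∑-distrib-+ lin (λ v → row v + col v)) (cong (λ t → sum lin + t) (∑-distrib-+ row col)))))))
  where
  lin row col : Fin k → ℚ
  lin v = l (suc v) * y (suc v)
  row v = M zero (suc v) * (y zero * y (suc v))
  col v = M (suc v) zero * (y (suc v) * y zero)
  inner : Fin k → Fin k → ℚ
  inner u v = M (suc u) (suc v) * (y (suc u) * y (suc v))
  rearrange : ∀ c l y a b d r → c + (l * y + a) + (0ℚ * (y * y) + b + (d + r)) ≡ c + l * y + (a + (b + d)) + r
  rearrange = solve-∀ ℚ-ring
  expand : ∀ l y m m′ y′ → (l + y * (m + m′)) * y′ ≡ l * y′ + (m * (y * y′) + m′ * (y′ * y))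
  expand = solve-∀ ℚ-ring

quadratic-affine : ∀ {k} c l₀ t (l m : Fin k → ℚ) M y →
  quadratic (c + l₀ * t) (λ v → l v + t * m v) M y ≡
  quadratic c l M y + t * (l₀ + sum (λ v → m v * y v))
quadratic-affine {k} c l₀ t l m M y =
  trans (cong (λ z → c + l₀ * t + z + ∑² (λ u v → M u v * (y u * y v)))
    (trans (sum-cong-≗ (λ v → expand (l v) t (m v) (y v)))
      (trans (∑-distrib-+ (λ v → l v * y v) (λ v → t * (m v * y v)))
        (cong (λ z → sum (λ v → l v * y v) + z) (sum-const-* t (λ v → m v * y v))))))
    (rearrange c l₀ t (sum (λ v → l v * y v)) (sum (λ v → m v * y v)) (∑² (λ u v → M u v * (y u * y v))))
  where
  expand : ∀ l t m y → (l + t * m) * y ≡ l * y + t * (m * y)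
  expand = solve-∀ ℚ-ring
  rearrange : ∀ c l t a b r → c + l * t + (a + t * b) + r ≡ c + a + r + t * (l + b)
  rearrange = solve-∀ ℚ-ring

-- Take the sign opposite to β. The bounds -1 ≤ y ≤ 1 are read off from y² ≤ 1 through 2 (1 ± y) = 1
-- - y² + (1 ± y)².
extremal-sign : ∀ β y → y * y ≤ 1ℚ → ∃ λ b → sign b * β ≤ y * β
extremal-sign β y y²≤1 with ≤-total 0ℚ β
... | inj₁ 0≤β = false , 0≤⇒≤ (nonNegative⁻¹ ½ ⊗ (≤⇒0≤ y²≤1 ⊕ square≥0 (y + 1ℚ)) ⊗ 0≤β) (factor y β)
  where
  factor : ∀ y β → y * β - (- 1ℚ) * β ≡ ½ * (1ℚ - y * y + (y + 1ℚ) * (y + 1ℚ)) * β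
  factor = solve-∀ ℚ-ring
... | inj₂ β≤0 = true , 0≤⇒≤ (nonNegative⁻¹ ½ ⊗ (≤⇒0≤ y²≤1 ⊕ square≥0 (1ℚ - y)) ⊗ ≤⇒0≤ β≤0) (factor y β)
  where
  factor : ∀ y β → y * β - 1ℚ * β ≡ ½ * (1ℚ - y * y + (1ℚ - y) * (1ℚ - y)) * (0ℚ - β)
  factor = solve-∀ ℚ-ring

signs : ∀ {k} → Vec Bool k → Fin k → ℚ
signs S v = sign (lookup S v)

-- The first variable has slope β once the others are held at `y′`, so it can be moved to a sign
-- without increasing the form; the remaining variables follow by induction.
extremal-signs : ∀ {k} c l (M : Fin k → Fin k → ℚ) → (∀ v → M v v ≡ 0ℚ) → ∀ y → (∀ v → y v * y v ≤ 1ℚ) →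
                 ∃ λ S → quadratic c l M (signs S) ≤ quadratic c l M y
extremal-signs {zero}  c l M Mᵥᵥ≡0 y y²≤1 = Vec.[] , ≤-refl
extremal-signs {suc k} c l M Mᵥᵥ≡0 y y²≤1 = b Vec.∷ S , (begin
  quadratic c l M (signs (b Vec.∷ S))
    ≡⟨ quadratic-head c l M (Mᵥᵥ≡0 zero) (signs (b Vec.∷ S)) ⟩
  quadratic (c + l zero * sign b) (l″ (sign b)) M′ (signs S) ≤⟨ proj₂ ih ⟩
  quadratic (c + l zero * sign b) (l″ (sign b)) M′ y′
    ≡⟨ quadratic-affine c (l zero) (sign b) l′ (cross M) M′ y′ ⟩
  quadratic c l′ M′ y′ + sign b * β
    ≤⟨ +-monoʳ-≤ (quadratic c l′ M′ y′) (proj₂ choice) ⟩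
  quadratic c l′ M′ y′ + y zero * β
    ≡⟨ quadratic-affine c (l zero) (y zero) l′ (cross M) M′ y′ ⟨
  quadratic (c + l zero * y zero) (l″ (y zero)) M′ y′        ≡⟨ quadratic-head c l M (Mᵥᵥ≡0 zero) y ⟨
  quadratic c l M y                                         ∎)
  where
  open ≤-Reasoning
  l′ y′ : Fin k → ℚ
  l′ v = l (suc v)
  y′ v = y (suc v)
  l″ : ℚ → Fin k → ℚ
  l″ t v = l′ v + t * cross M v
  M′ : Fin k → Fin k → ℚ
  M′ u v = M (suc u) (suc v)
  β : ℚ
  β = l zero + sum (λ v → cross M v * y′ v)
  choice = extremal-sign β (y zero) (y²≤1 zero)
  b = proj₁ choice
  ih = extremal-signs (c + l zero * sign b) (l″ (sign b)) M′ (λ v → Mᵥᵥ≡0 (suc v)) y′ (λ v → y²≤1 (suc v))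
  S = proj₁ ih

ι-sum : ∀ {k} (f : Fin k → ℕ) → ι (ListAction.sum (List.map f (List.allFin k))) ≡ ∑[ i < k ] ι (f i)
ι-sum f = trans (cong (λ xs → ι (ListAction.sum xs)) (map-tabulate (λ i → i) f)) (ι-sum-tabulate f)
  where
  ι-sum-tabulate : ∀ {k} (f : Fin k → ℕ) → ι (ListAction.sum (List.tabulate f)) ≡ ∑[ i < k ] ι (f i)
  ι-sum-tabulate {zero}  f = refl
  ι-sum-tabulate {suc k} f = trans (ι-+ (f zero) _) (cong (λ t → ι (f zero) + t) (ι-sum-tabulate (λ i → f (suc i))))

ι-if : ∀ b → ι (if b then 1 else 0) ≡ 𝟙 b
ι-if true  = refl
ι-if false = refl

ι-countPairs : ∀ k P → ι (countPairs k P) ≡ ∑² (λ u v → 𝟙 ((toℕ u <ᵇ toℕ v) ∧ P u v))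
ι-countPairs k P = trans (ι-sum {k} (λ u → ListAction.sum (List.map (λ v → if (toℕ u <ᵇ toℕ v) ∧ P u v then 1 else 0) (List.allFin k))))
  (sum-cong-≗ λ u → trans (ι-sum {k} (λ v → if (toℕ u <ᵇ toℕ v) ∧ P u v then 1 else 0))
    (sum-cong-≗ λ v → ι-if ((toℕ u <ᵇ toℕ v) ∧ P u v)))

<⇒<ᵇ≡true : ∀ {a b} → a ℕ.< b → (a <ᵇ b) ≡ true
<⇒<ᵇ≡true {zero}  {suc b} _           = refl
<⇒<ᵇ≡true {suc a} {suc b} (ℕ.s≤s a<b) = <⇒<ᵇ≡true a<b

≤⇒<ᵇ≡false : ∀ {a b} → b ℕ.≤ a → (a <ᵇ b) ≡ false
≤⇒<ᵇ≡false {a}     {zero}  _           = refl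
≤⇒<ᵇ≡false {suc a} {suc b} (ℕ.s≤s b≤a) = ≤⇒<ᵇ≡false b≤a

countPairs-double : ∀ k P → (∀ u v → P u v ≡ P v u) → (∀ v → P v v ≡ false) →
                    ι (countPairs k P) + ι (countPairs k P) ≡ ∑² (λ u v → 𝟙 (P u v))
countPairs-double k P P-sym P-irrefl =
  trans (cong₂ _+_ (ι-countPairs k P) (trans (ι-countPairs k P) (∑-comm (λ u v → 𝟙 ((toℕ u <ᵇ toℕ v) ∧ P u v)))))
    (trans (sym (∑²-+ (λ u v → 𝟙 ((toℕ u <ᵇ toℕ v) ∧ P u v)) (λ u v → 𝟙 ((toℕ v <ᵇ toℕ u) ∧ P v u))))
      (∑²-cong pointwise))
  where
  pointwise : ∀ u v → 𝟙 ((toℕ u <ᵇ toℕ v) ∧ P u v) + 𝟙 ((toℕ v <ᵇ toℕ u) ∧ P v u) ≡ 𝟙 (P u v)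
  pointwise u v with ℕ.<-cmp (toℕ u) (toℕ v)
  ... | tri< u<v _ _ rewrite <⇒<ᵇ≡true u<v | ≤⇒<ᵇ≡false (ℕ.<⇒≤ u<v) = +-identityʳ (𝟙 (P u v))
  ... | tri> _ _ v<u rewrite <⇒<ᵇ≡true v<u | ≤⇒<ᵇ≡false (ℕ.<⇒≤ v<u) | P-sym u v = +-identityˡ (𝟙 (P v u))
  ... | tri≈ _ u≡v _ rewrite toℕ-injective u≡v | ≤⇒<ᵇ≡false (ℕ.≤-refl {toℕ v}) | P-irrefl v = refl

∈-allParts : ∀ {k} (S : Vec Bool k) → S ∈ allParts k
∈-allParts Vec.[] = here refl
∈-allParts (true  Vec.∷ S) = ∈-++⁺ˡ (∈-map⁺ (true Vec.∷_) (∈-allParts S))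
∈-allParts (false Vec.∷ S) = ∈-++⁺ʳ _ (∈-map⁺ (false Vec.∷_) (∈-allParts S))

≤-foldr-⊔ : ∀ {A : Set} (f : A → ℕ) {x xs} → x ∈ xs → f x ℕ.≤ List.foldr (λ y acc → f y ℕ.⊔ acc) 0 xs
≤-foldr-⊔ f (here refl)          = ℕ.m≤m⊔n _ _
≤-foldr-⊔ f (there {x = y} x∈xs) = ℕ.≤-trans (≤-foldr-⊔ f x∈xs) (ℕ.m≤n⊔m (f y) _)

module _ (G : Graph) where

  A : Fin (n G) → Fin (n G) → ℚ
  A u v = 𝟙 (adj G u v)

  -- Twice sp(G).
  surplus : ℚ
  surplus = ι (2 ℕ.* mc G ∸ e G)

  2e≡∑A : ι (e G) + ι (e G) ≡ ∑² A
  2e≡∑A = countPairs-double (n G) (adj G) (Graph.sym G) (irref G)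

  ≠ᵇ-comm : ∀ a b → (a ≠ᵇ b) ≡ (b ≠ᵇ a)
  ≠ᵇ-comm true  true  = refl
  ≠ᵇ-comm true  false = refl
  ≠ᵇ-comm false true  = refl
  ≠ᵇ-comm false false = refl

  cut-signs : ∀ S → 4ℚ * ι (cut G S) ≡ ∑² A + ∑² (λ u v → A u v * (- (signs S u * signs S v)))
  cut-signs S = trans (split (ι (cut G S))) (trans (cong (λ t → 2ℚ * t) (countPairs-double (n G) crossing crossing-sym crossing-irrefl))
    (trans (sym (∑²-* 2ℚ (λ u v → 𝟙 (crossing u v))))
      (trans (∑²-cong λ u v → pointwise (adj G u v) (lookup S u) (lookup S v))
        (∑²-+ A (λ u v → A u v * (- (signs S u * signs S v)))))))
    where
    crossing : Fin (n G) → Fin (n G) → Bool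
    crossing u v = adj G u v ∧ (lookup S u ≠ᵇ lookup S v)
    crossing-sym : ∀ u v → crossing u v ≡ crossing v u
    crossing-sym u v = cong₂ _∧_ (Graph.sym G u v) (≠ᵇ-comm (lookup S u) (lookup S v))
    crossing-irrefl : ∀ v → crossing v v ≡ false
    crossing-irrefl v rewrite irref G v = refl
    split : ∀ x → 4ℚ * x ≡ 2ℚ * (x + x)
    split = solve-∀ ℚ-ring
    pointwise : ∀ a s t → 2ℚ * 𝟙 (a ∧ (s ≠ᵇ t)) ≡ 𝟙 a + 𝟙 a * (- (sign s * sign t))
    pointwise false s     t     = sym (trans (+-identityˡ _) (*-zeroˡ (- (sign s * sign t))))
    pointwise true  true  true  = refl
    pointwise true  true  false = refl
    pointwise true  false true  = refl
    pointwise true  false false = refl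

  signs-bound : ∀ S → ∑² (λ u v → A u v * (- (signs S u * signs S v))) ≤ 2ℚ * surplus
  signs-bound S = lemma (ι (cut G S)) (ι (mc G)) (ι (e G)) surplus (∑² A) _ (cut-signs S) 2e≡∑A
    (ι-mono (≤-foldr-⊔ (cut G) (∈-allParts S)))
    -- Truncated subtraction is never below the true difference, so this direction holds without
    -- comparing 2 mc and e.
    (subst₂ _≤_ (ι-* 2 (mc G)) (ι-+ (e G) (2 ℕ.* mc G ∸ e G)) (ι-mono (ℕ.m≤n+m∸n (2 ℕ.* mc G) (e G))))
    where
    lemma : ∀ c m e s a f → 4ℚ * c ≡ a + f → e + e ≡ a → c ≤ m → 2ℚ * m ≤ e + s → f ≤ 2ℚ * s
    lemma c m e s a f eq refl c≤m 2m≤e+s = 0≤⇒≤ (nonNegative⁻¹ 2ℚ ⊗ (≤⇒0≤ 2m≤e+s ⊕ nonNegative⁻¹ 2ℚ ⊗ ≤⇒0≤ c≤m))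
      (trans (cong (λ t → 2ℚ * s - t) (trans (isolate e f) (cong (λ t → t - (e + e)) (sym eq)))) (collect c m e s))
      where
      isolate : ∀ e f → f ≡ e + e + f - (e + e)
      isolate = solve-∀ ℚ-ring
      collect : ∀ c m e s → 2ℚ * s - (4ℚ * c - (e + e)) ≡ 2ℚ * (e + s - 2ℚ * m + 2ℚ * (m - c))
      collect = solve-∀ ℚ-ring

  form-bound : ∀ y → (∀ v → y v * y v ≤ 1ℚ) → ∑² (λ u v → A u v * (- (y u * y v))) ≤ 2ℚ * surplus
  form-bound y y²≤1 = begin
    ∑² (λ u v → A u v * (- (y u * y v)))             ≡⟨ negate y ⟩
    - ∑² (λ u v → A u v * (y u * y v))               ≤⟨ neg-antimono-≤ S≤y ⟩
    - ∑² (λ u v → A u v * (signs S u * signs S v))   ≡⟨ negate (signs S) ⟨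
    ∑² (λ u v → A u v * (- (signs S u * signs S v))) ≤⟨ signs-bound S ⟩
    2ℚ * surplus                                     ∎
    where
    open ≤-Reasoning
    extremal = extremal-signs 0ℚ (λ _ → 0ℚ) A (λ v → cong 𝟙 (irref G v)) y y²≤1
    S = proj₁ extremal
    form : (Fin (n G) → ℚ) → ℚ
    form z = ∑² (λ u v → A u v * (z u * z v))
    no-linear : ∀ z → quadratic 0ℚ (λ _ → 0ℚ) A z ≡ form z
    no-linear z = trans (cong (λ t → 0ℚ + t + form z) (trans (sum-const-* 0ℚ z) (*-zeroˡ (sum z))))
      (+-identityˡ (form z))
    S≤y : form (signs S) ≤ form y
    S≤y = subst₂ _≤_ (no-linear (signs S)) (no-linear y) (proj₂ extremal)
    negate : ∀ z → ∑² (λ u v → A u v * (- (z u * z v))) ≡ - form z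
    negate z = trans (∑²-cong λ u v → pull (A u v) (z u * z v))
      (trans (∑²-* (- 1ℚ) (λ u v → A u v * (z u * z v))) (neg-one (form z)))
      where
      pull : ∀ a b → a * (- b) ≡ - 1ℚ * (a * b)
      pull = solve-∀ ℚ-ring
      neg-one : ∀ a → - 1ℚ * a ≡ - a
      neg-one = solve-∀ ℚ-ring

  cut-rounding : ∀ L → (∀ v → sumL (norm v) L ≤ ⅛) →
                 ∑² (λ u v → A u v * sumL (λ s → gain s u v) L) ≤ 8ℚ * surplus
  cut-rounding L norms = ≤-trans (rounding (λ u v → 0≤𝟙 (adj G u v)) form-bound L norms) (≤-reflexive (regroup surplus))
    where
    regroup : ∀ s → 4ℚ * (2ℚ * s) ≡ 8ℚ * s
    regroup = solve-∀ ℚ-ring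

𝟙≤ : ∀ {b x} → 0ℚ ≤ x → (b ≡ true → 1ℚ ≤ x) → 𝟙 b ≤ x
𝟙≤ {true}  0≤x h = h refl
𝟙≤ {false} 0≤x h = 0≤x

𝟙*-mono : ∀ {b x y} → (b ≡ true → x ≤ y) → 𝟙 b * x ≤ 𝟙 b * y
𝟙*-mono {true}  {x} {y} h = subst₂ _≤_ (sym (*-identityˡ x)) (sym (*-identityˡ y)) (h refl)
𝟙*-mono {false} {x} {y} h = ≤-reflexive (trans (*-zeroˡ x) (sym (*-zeroˡ y)))

1≤+ˡ : ∀ {x y} → x ≡ 1ℚ → 0ℚ ≤ y → 1ℚ ≤ x + y
1≤+ˡ {y = y} refl 0≤y = subst (_≤ 1ℚ + y) (+-identityʳ 1ℚ) (+-monoʳ-≤ 1ℚ 0≤y)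

1≤+ʳ : ∀ {x y} → 0ℚ ≤ x → 1ℚ ≤ y → 1ℚ ≤ x + y
1≤+ʳ {x} {y} 0≤x 1≤y = subst (_≤ x + y) (+-identityˡ 1ℚ) (+-mono-≤ 0≤x 1≤y)

truncate : ∀ {x y} → 0ℚ ≤ y → (x≤?y : Dec (x ≤ y)) → 𝟙 (does x≤?y) * x ≤ y
truncate {x} 0≤y (yes x≤y) = ≤-trans (≤-reflexive (*-identityˡ x)) x≤y
truncate {x} 0≤y (no  _)   = ≤-trans (≤-reflexive (*-zeroˡ x)) 0≤y

sum-δ : ∀ {k} (a : Fin k) → ∑[ y < k ] 𝟙 (does (a ≟ y)) ≡ 1ℚ
sum-δ {suc k} zero    = trans (cong (λ t → 1ℚ + t) (sum-replicate-zero k)) (+-identityʳ 1ℚ)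
sum-δ {suc k} (suc a) = trans (+-identityˡ _) (sum-δ a)

-- Supplies a new cycle vertex that avoids two chosen ones, which may coincide. If there is none,
-- the indicator of `P` is dominated by those of a and b.
sum>2⇒third : ∀ {k} (P : Fin k → Bool) (a b : Fin k) →
  ∑[ y < k ] 𝟙 (P y) ≤ 2ℚ ⊎ ∃ λ y → P y ≡ true × y ≢ a × y ≢ b
sum>2⇒third {k} P a b with any? (λ y → (P y Bool.≟ true) ×-dec (¬? (y ≟ a) ×-dec ¬? (y ≟ b)))
... | yes third = inj₂ third
... | no  none  = inj₁ (≤-trans (sum-mono pointwise)
      (≤-reflexive (trans (∑-distrib-+ (λ y → 𝟙 (does (a ≟ y))) (λ y → 𝟙 (does (b ≟ y))))
        (cong₂ _+_ (sum-δ a) (sum-δ b)))))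
  where
  pointwise : ∀ y → 𝟙 (P y) ≤ 𝟙 (does (a ≟ y)) + 𝟙 (does (b ≟ y))
  pointwise y = 𝟙≤ (0≤𝟙 (does (a ≟ y)) ⊕ 0≤𝟙 (does (b ≟ y))) one
    where
    one : P y ≡ true → 1ℚ ≤ 𝟙 (does (a ≟ y)) + 𝟙 (does (b ≟ y))
    one Py with a ≟ y | b ≟ y
    ... | yes _   | yes _   = ≤ᵇ⇒≤ _
    ... | yes _   | no  _   = ≤-refl
    ... | no  _   | yes _   = ≤-refl
    ... | no  a≢y | no  b≢y = contradiction (y , Py , (λ y≡a → a≢y (sym y≡a)) , (λ y≡b → b≢y (sym y≡b))) none

-- Local counts in regular C5-free graphs

module C5FreeRegular (G : Graph) (C5-free : C5Free G) (d : ℕ) (regular : ∀ v → deg G v ≡ d) where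

  V : Set
  V = Fin (n G)

  _~_ : V → V → Set
  u ~ v = adj G u v ≡ true

  ~-sym : ∀ {u v} → u ~ v → v ~ u
  ~-sym {u} {v} u~v = trans (Graph.sym G v u) u~v

  ~⇒≢ : ∀ {u v} → u ~ v → u ≢ v
  ~⇒≢ {u} u~v refl with trans (sym u~v) (irref G u)
  ... | ()

  separated : ∀ {u v w} → u ~ w → adj G v w ≡ false → u ≢ v
  separated u~w v≁w refl with trans (sym u~w) v≁w
  ... | ()

  -- Consecutive vertices differ by irreflexivity, so only the five diagonals have to be checked.
  no-C5 : ∀ {v₀ v₁ v₂ v₃ v₄} → v₀ ~ v₁ → v₁ ~ v₂ → v₂ ~ v₃ → v₃ ~ v₄ → v₄ ~ v₀ →
          v₀ ≢ v₂ → v₀ ≢ v₃ → v₁ ≢ v₃ → v₁ ≢ v₄ → v₂ ≢ v₄ → ⊥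
  no-C5 {v₀} {v₁} {v₂} {v₃} {v₄} e₀₁ e₁₂ e₂₃ e₃₄ e₄₀ d₀₂ d₀₃ d₁₃ d₁₄ d₂₄ =
    C5-free (lookup cycle , (λ i j i≢j vᵢ≡vⱼ → i≢j (lookup-injective distinct i j vᵢ≡vⱼ)) ,
             e₀₁ , e₁₂ , e₂₃ , e₃₄ , e₄₀)
    where
    cycle : Vec V 5
    cycle = v₀ Vec.∷ v₁ Vec.∷ v₂ Vec.∷ v₃ Vec.∷ v₄ Vec.∷ Vec.[]
    distinct : Unique cycle
    distinct =
      (~⇒≢ e₀₁ VecAll.∷ d₀₂ VecAll.∷ d₀₃ VecAll.∷ (λ eq → ~⇒≢ e₄₀ (sym eq)) VecAll.∷ VecAll.[]) AllPairs.∷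
      (~⇒≢ e₁₂ VecAll.∷ d₁₃ VecAll.∷ d₁₄ VecAll.∷ VecAll.[]) AllPairs.∷
      (~⇒≢ e₂₃ VecAll.∷ d₂₄ VecAll.∷ VecAll.[]) AllPairs.∷
      (~⇒≢ e₃₄ VecAll.∷ VecAll.[]) AllPairs.∷
      VecAll.[] AllPairs.∷ AllPairs.[]

  second : V → V → Bool
  second v w = not (does (v ≟ w)) ∧ (not (adj G v w) ∧ does (any? λ a → (adj G v a Bool.≟ true) ×-dec (adj G a w Bool.≟ true)))

  second⇒ : ∀ {v w} → second v w ≡ true → v ≢ w × adj G v w ≡ false × ∃ λ a → v ~ a × a ~ w
  second⇒ {v} {w} eq with v ≟ w | adj G v w in v≁w | any? (λ a → (adj G v a Bool.≟ true) ×-dec (adj G a w Bool.≟ true))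
  ... | no v≢w | false | yes walk = v≢w , refl , walk

  second⇒≁ : ∀ {v w} → second v w ≡ true → ¬ (v ~ w)
  second⇒≁ vw v~w with trans (sym v~w) (proj₁ (proj₂ (second⇒ vw)))
  ... | ()

  ⇒second : ∀ {v a w} → v ≢ w → adj G v w ≡ false → v ~ a → a ~ w → second v w ≡ true
  ⇒second {v} {a} {w} v≢w v≁w v~a a~w
    rewrite dec-false (v ≟ w) v≢w | v≁w
          | dec-true (any? λ a → (adj G v a Bool.≟ true) ×-dec (adj G a w Bool.≟ true)) (a , v~a , a~w) = refl

  ∣V∣ D : ℚ
  ∣V∣ = ι (n G)
  D   = ι d

  0≤D : 0ℚ ≤ D
  0≤D = ι-nonneg d

  E N I : V → V → ℚ
  E = A G
  N v w = 𝟙 (second v w)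
  I v w = 𝟙 (does (v ≟ w))

  0≤E : ∀ u v → 0ℚ ≤ E u v
  0≤E u v = 0≤𝟙 (adj G u v)

  0≤N : ∀ u v → 0ℚ ≤ N u v
  0≤N u v = 0≤𝟙 (second u v)

  0≤I : ∀ u v → 0ℚ ≤ I u v
  0≤I u v = 0≤𝟙 (does (u ≟ v))

  E≡1 : ∀ {u v} → u ~ v → E u v ≡ 1ℚ
  E≡1 u~v = cong 𝟙 u~v

  E-sym : ∀ u v → E u v ≡ E v u
  E-sym u v = cong 𝟙 (Graph.sym G u v)

  ∑E≡D : ∀ v → ∑[ u < n G ] E v u ≡ D
  ∑E≡D v = trans (sym (trans (ι-sum (λ u → if adj G v u then 1 else 0)) (sum-cong-≗ (λ u → ι-if (adj G v u)))))
                 (cong ι (regular v))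

  ∑E* : ∀ v x → ∑[ u < n G ] (E v u * x) ≡ D * x
  ∑E* v x = trans (sym (*-distribʳ-sum x (E v))) (cong (λ t → t * x) (∑E≡D v))

  triangles paths overlaps : V → ℚ
  triangles v = ∑² λ u w → E v u * (E v w * E u w)
  paths     v = ∑² λ u w → E v u * (E u w * N v w)
  overlaps  v = ∑² λ u w → E v u * (N u w * N v w)

  size : V → ℚ
  size v = ∑[ w < n G ] N v w

  0≤size : ∀ v → 0ℚ ≤ size v
  0≤size v = sum-nonneg (0≤N v)

  codeg : V → V → ℚ
  codeg v u = ∑[ w < n G ] (E v w * E u w)

  𝟙-∧ : ∀ a b → 𝟙 (a ∧ b) ≡ 𝟙 a * 𝟙 b
  𝟙-∧ true  b = sym (*-identityˡ (𝟙 b))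
  𝟙-∧ false b = sym (*-zeroˡ (𝟙 b))

  third-common : ∀ v u a b → codeg v u ≤ 2ℚ ⊎ ∃ λ y → v ~ y × u ~ y × y ≢ a × y ≢ b
  third-common v u a b with sum>2⇒third (λ y → adj G v y ∧ adj G u y) a b
  ... | inj₁ ≤2 = inj₁ (subst (_≤ 2ℚ) (sum-cong-≗ (λ y → 𝟙-∧ (adj G v y) (adj G u y))) ≤2)
  ... | inj₂ (y , both , y≢a , y≢b) = inj₂ (y , proj₁ (split _ _ both) , proj₂ (split _ _ both) , y≢a , y≢b)
    where
    split : ∀ p q → p ∧ q ≡ true → p ≡ true × q ≡ true
    split true true _ = refl , refl

  -- A neighbourhood contains no path with three edges, so each of its edges has an end of
  -- degree at most 2 there.
  triangle-edge : ∀ {v u w} → v ~ u → v ~ w → u ~ w → codeg v u ≤ 2ℚ ⊎ codeg v w ≤ 2ℚ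
  triangle-edge {v} {u} {w} v~u v~w u~w with third-common v u w w
  ... | inj₁ small = inj₁ small
  ... | inj₂ (x , v~x , u~x , x≢w , _) with third-common v w u x
  ...   | inj₁ small = inj₂ small
  ...   | inj₂ (y , v~y , w~y , y≢u , y≢x) =
    contradiction (~-sym v~y) λ y~v →
      no-C5 v~x (~-sym u~x) u~w w~y y~v (~⇒≢ v~u) (~⇒≢ v~w) x≢w (λ x≡y → y≢x (sym x≡y)) (λ u≡y → y≢u (sym u≡y))

  light : V → V → Bool
  light v u = does (codeg v u ≤? 2ℚ)

  -- Each ordered edge inside the neighbourhood of v is charged to an end of degree at most 2 there.
  -- A neighbour receives at most 2 charges in each of the two positions.
  triangles≤4D : ∀ v → triangles v ≤ 4ℚ * D
  triangles≤4D v = begin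
    triangles v                                                       ≤⟨ ∑²-mono pointwise ⟩
    ∑² (λ u w → first u w + first w u)                                ≡⟨ ∑²-+ first (λ u w → first w u) ⟩
    ∑² first + ∑² (λ u w → first w u)
      ≡⟨ cong (λ t → ∑² first + t) (∑-comm (λ u w → first w u)) ⟩
    ∑² first + ∑² first                                               ≤⟨ +-mono-≤ ∑first ∑first ⟩
    D * 2ℚ + D * 2ℚ                                                   ≡⟨ regroup D ⟩
    4ℚ * D                                                            ∎
    where
    open ≤-Reasoning
    regroup : ∀ d → d * 2ℚ + d * 2ℚ ≡ 4ℚ * d
    regroup = solve-∀ ℚ-ring
    first : V → V → ℚ
    first u w = E v u * (𝟙 (light v u) * (E v w * E u w))
    χ : V → ℚ
    χ u = 𝟙 (light v u)
    χ≡1 : ∀ {u} → codeg v u ≤ 2ℚ → χ u ≡ 1ℚ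
    χ≡1 {u} h = cong 𝟙 (dec-true (codeg v u ≤? 2ℚ) h)
    one : ∀ {u w} → codeg v u ≤ 2ℚ ⊎ codeg v w ≤ 2ℚ → 1ℚ ≤ χ u + χ w
    one {u} {w} (inj₁ h) = 1≤+ˡ (χ≡1 h) (0≤𝟙 (light v w))
    one {u} {w} (inj₂ h) = 1≤+ʳ (0≤𝟙 (light v u)) (≤-reflexive (sym (χ≡1 h)))
    pointwise : ∀ u w → E v u * (E v w * E u w) ≤ first u w + first w u
    pointwise u w = begin
      E v u * (E v w * E u w)               ≡⟨ cong (λ t → E v u * (E v w * t)) (sym (*-identityʳ (E u w))) ⟩
      E v u * (E v w * (E u w * 1ℚ))
        ≤⟨ 𝟙*-mono (λ v~u → 𝟙*-mono λ v~w → 𝟙*-mono λ u~w → one (triangle-edge v~u v~w u~w)) ⟩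
      E v u * (E v w * (E u w * (χ u + χ w))) ≡⟨ expand (E v u) (E v w) (E u w) (χ u) (χ w) ⟩
      first u w + E v w * (χ w * (E v u * E u w))
        ≡⟨ cong (λ t → first u w + E v w * (χ w * (E v u * t))) (E-sym u w) ⟩
      first u w + first w u                 ∎
      where
      expand : ∀ a b c x y → a * (b * (c * (x + y))) ≡ a * (x * (b * c)) + b * (y * (a * c))
      expand = solve-∀ ℚ-ring
    ∑first : ∑² first ≤ D * 2ℚ
    ∑first = ≤-trans (sum-mono row) (≤-reflexive (∑E* v 2ℚ))
      where
      χ-codeg : ∀ u → χ u * codeg v u ≤ 2ℚ
      χ-codeg u = truncate (nonNegative⁻¹ 2ℚ) (codeg v u ≤? 2ℚ)
      row : ∀ u → ∑[ w < n G ] (first u w) ≤ E v u * 2ℚ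
      row u = begin
        ∑[ w < n G ] (first u w) ≡⟨ sum-const-* (E v u) (λ w → χ u * (E v w * E u w)) ⟩
        E v u * ∑[ w < n G ] (χ u * (E v w * E u w))
          ≡⟨ cong (λ t → E v u * t) (sum-const-* (χ u) (λ w → E v w * E u w)) ⟩
        E v u * (χ u * codeg v u) ≤⟨ 𝟙*-mono {adj G v u} (λ _ → χ-codeg u) ⟩
        E v u * 2ℚ ∎

  -- Of the D² walks of length two from v, D return to v, at most 4 D end at a neighbour, and the
  -- others end in the second neighbourhood.
  D²≤5D+paths : ∀ v → D * D ≤ (ℤ.+ 5 / 1) * D + paths v
  D²≤5D+paths v = begin
    D * D                                                          ≡⟨ ∑E* v D ⟨
    ∑[ u < n G ] (E v u * D)
      ≡⟨ sum-cong-≗ (λ u → cong (λ t → E v u * t) (sym (∑E≡D u))) ⟩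
    ∑[ u < n G ] (E v u * ∑[ w < n G ] E u w)
      ≡⟨ sum-cong-≗ (λ u → sym (sum-const-* (E v u) (E u))) ⟩
    ∑² (λ u w → E v u * E u w)                                     ≤⟨ ∑²-mono pointwise ⟩
    ∑² (λ u w → E v u * I v w + (tri u w + path u w))
      ≡⟨ ∑²-+ (λ u w → E v u * I v w) (λ u w → tri u w + path u w) ⟩
    ∑² (λ u w → E v u * I v w) + ∑² (λ u w → tri u w + path u w)   ≡⟨ cong₂ _+_ returning (∑²-+ tri path) ⟩
    D * 1ℚ + (triangles v + paths v)
      ≤⟨ +-monoʳ-≤ (D * 1ℚ) (+-monoˡ-≤ (paths v) (triangles≤4D v)) ⟩
    D * 1ℚ + (4ℚ * D + paths v)                                    ≡⟨ regroup D (paths v) ⟩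
    (ℤ.+ 5 / 1) * D + paths v                                      ∎
    where
    open ≤-Reasoning
    tri path : V → V → ℚ
    tri  u w = E v u * (E v w * E u w)
    path u w = E v u * (E u w * N v w)
    regroup : ∀ d p → d * 1ℚ + (4ℚ * d + p) ≡ (ℤ.+ 5 / 1) * d + p
    regroup = solve-∀ ℚ-ring
    returning : ∑² (λ u w → E v u * I v w) ≡ D * 1ℚ
    returning = trans (sum-cong-≗ (λ u → trans (sum-const-* (E v u) (I v)) (cong (λ t → E v u * t) (sum-δ v)))) (∑E* v 1ℚ)
    pointwise : ∀ u w → E v u * E u w ≤ E v u * I v w + (tri u w + path u w)
    pointwise u w = ≤-trans (𝟙*-mono λ v~u → 𝟙≤ {adj G u w} nonneg (cases v~u))
        (≤-reflexive (expand (E v u) (I v w) (E v w * E u w) (E u w * N v w)))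
      where
      nonneg : 0ℚ ≤ I v w + (E v w * E u w + E u w * N v w)
      nonneg = 0≤I v w ⊕ (0≤E v w ⊗ 0≤E u w ⊕ 0≤E u w ⊗ 0≤N v w)
      expand : ∀ a x y z → a * (x + (y + z)) ≡ a * x + (a * y + a * z)
      expand = solve-∀ ℚ-ring
      cases : v ~ u → u ~ w → 1ℚ ≤ I v w + (E v w * E u w + E u w * N v w)
      cases v~u u~w = by-position (v ≟ w) (adj G v w) refl
        where
        by-position : Dec (v ≡ w) → ∀ b → adj G v w ≡ b → 1ℚ ≤ I v w + (E v w * E u w + E u w * N v w)
        by-position (yes v≡w) _     _   = 1≤+ˡ (cong 𝟙 (dec-true (v ≟ w) v≡w)) (0≤E v w ⊗ 0≤E u w ⊕ 0≤E u w ⊗ 0≤N v w)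
        by-position (no  v≢w) true  v~w = 1≤+ʳ (0≤I v w) (1≤+ˡ (cong₂ _*_ (E≡1 v~w) (E≡1 u~w)) (0≤E u w ⊗ 0≤N v w))
        by-position (no  v≢w) false v≁w = 1≤+ʳ (0≤I v w) (1≤+ʳ (0≤E v w ⊗ 0≤E u w)
          (≤-reflexive (sym (cong₂ _*_ (E≡1 u~w) (cong 𝟙 (⇒second v≢w v≁w v~u u~w))))))

  -- If u ∼ v and w lies in both second neighbourhoods, then u, a, w, b, v is a C5 for any
  -- middle vertices a ≠ b; so a = b completes a triangle with u and v.
  overlaps≤4D² : ∀ v → overlaps v ≤ 4ℚ * (D * D)
  overlaps≤4D² v = begin
    overlaps v
      ≤⟨ sum-mono (λ u → sum-mono (λ w → 𝟙*-mono (through u w))) ⟩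
    ∑² (λ u w → E v u * ∑[ a < n G ] (via u w a))                    ≡⟨ sum-cong-≗ row ⟩
    ∑² (λ u a → D * (E v u * (E v a * E u a)))
      ≡⟨ ∑²-* D (λ u a → E v u * (E v a * E u a)) ⟩
    D * triangles v
      ≤⟨ *-mono-≤ 0≤D (nonNegative⁻¹ 4ℚ ⊗ 0≤D) ≤-refl (triangles≤4D v) ⟩
    D * (4ℚ * D)                                                   ≡⟨ regroup D ⟩
    4ℚ * (D * D)                                                   ∎
    where
    open ≤-Reasoning
    regroup : ∀ d → d * (4ℚ * d) ≡ 4ℚ * (d * d)
    regroup = solve-∀ ℚ-ring
    -- The conditions on w and on the triangle v, u, a separate, so summing over w contributes a
    -- factor D for each triangle.
    via : V → V → V → ℚ
    via u w a = (E v a * E u a) * E a w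
    0≤via : ∀ u w a → 0ℚ ≤ via u w a
    0≤via u w a = (0≤E v a ⊗ 0≤E u a) ⊗ 0≤E a w
    row : ∀ u → ∑[ w < n G ] (E v u * ∑[ a < n G ] (via u w a)) ≡ ∑[ a < n G ] (D * (E v u * (E v a * E u a)))
    row u = trans (sum-const-* (E v u) (λ w → sum (via u w))) (trans (cong (λ t → E v u * t)
              (trans (∑-comm (λ w a → via u w a)) (sum-cong-≗ λ a → trans (sum-const-* (E v a * E u a) (E a)) (cong (λ t → E v a * E u a * t) (∑E≡D a)))))
              (trans (sym (sum-const-* (E v u) (λ a → E v a * E u a * D))) (sum-cong-≗ λ a → commute (E v u) (E v a * E u a) D)))
      where
      commute : ∀ x y z → x * (y * z) ≡ z * (x * y)
      commute = solve-∀ ℚ-ring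
    through : ∀ u w → v ~ u → N u w * N v w ≤ ∑[ a < n G ] (via u w a)
    through u w v~u = subst (_≤ sum (via u w)) (𝟙-∧ (second u w) (second v w))
        (𝟙≤ (sum-nonneg (0≤via u w)) both)
      where
      both : second u w ∧ second v w ≡ true → 1ℚ ≤ sum (via u w)
      both eq with second u w in su | second v w in sv
      both refl | true | true with second⇒ su | second⇒ sv
      ... | u≢w , u≁w , a , u~a , a~w | v≢w , v≁w , b , v~b , b~w with a ≟ b
      ...   | yes refl = ≤-trans (≤-reflexive one) (term≤sum (0≤via u w) a)
        where
        one : 1ℚ ≡ via u w a
        one = sym (cong₂ _*_ (cong₂ _*_ (E≡1 v~b) (E≡1 u~a)) (E≡1 a~w))
      ...   | no a≢b = contradiction a≢b λ _ →
        no-C5 u~a a~w (~-sym b~w) (~-sym v~b) v~u u≢w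
          (λ u≡b → separated b~w u≁w (sym u≡b)) a≢b (separated a~w v≁w) (λ w≡v → v≢w (sym w≡v))

  size≤D² : ∀ v → size v ≤ D * D
  size≤D² v = begin
    size v                                      ≤⟨ sum-mono pointwise ⟩
    ∑[ w < n G ] ∑[ u < n G ] (E v u * E u w)   ≡⟨ ∑-comm (λ w u → E v u * E u w) ⟩
    ∑[ u < n G ] ∑[ w < n G ] (E v u * E u w)
      ≡⟨ sum-cong-≗ (λ u → trans (sum-const-* (E v u) (E u)) (cong (λ t → E v u * t) (∑E≡D u))) ⟩
    ∑[ u < n G ] (E v u * D)                      ≡⟨ ∑E* v D ⟩
    D * D                                       ∎
    where
    open ≤-Reasoning
    0≤EE : ∀ w u → 0ℚ ≤ E v u * E u w
    0≤EE w u = 0≤E v u ⊗ 0≤E u w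
    pointwise : ∀ w → N v w ≤ ∑[ u < n G ] (E v u * E u w)
    pointwise w = 𝟙≤ (sum-nonneg (0≤EE w)) witness
      where
      witness : second v w ≡ true → 1ℚ ≤ ∑[ u < n G ] (E v u * E u w)
      witness sv with second⇒ sv
      ... | _ , _ , a , v~a , a~w =
        ≤-trans (≤-reflexive (sym (cong₂ _*_ (E≡1 v~a) (E≡1 a~w)))) (term≤sum (0≤EE w) a)

  paths≤D*size : ∀ v → paths v ≤ D * size v
  paths≤D*size v = begin
    paths v
      ≤⟨ sum-mono (λ u → sum-mono (λ w → 𝟙*-mono {adj G v u} (λ _ → drop (adj G u w) (N v w) (0≤N v w)))) ⟩
    ∑² (λ u w → E v u * N v w)       ≡⟨ sum-cong-≗ (λ u → sum-const-* (E v u) (N v)) ⟩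
    ∑[ u < n G ] (E v u * size v)      ≡⟨ ∑E* v (size v) ⟩
    D * size v                       ∎
    where
    open ≤-Reasoning
    drop : ∀ b x → 0ℚ ≤ x → 𝟙 b * x ≤ x
    drop true  x 0≤x = ≤-reflexive (*-identityˡ x)
    drop false x 0≤x = ≤-trans (≤-reflexive (*-zeroˡ x)) 0≤x

-- Rational inverse square roots up to a factor 2

square-cancel-≤ : ∀ {a b} → 0ℚ ≤ b → a * a ≤ b * b → a ≤ b
square-cancel-≤ {a} {b} 0≤b a²≤b² with a ≤? b
... | yes a≤b = a≤b
... | no  a≰b = contradiction (<-≤-trans (≤-<-trans b²≤ab ab<a²) a²≤b²) (<-irrefl refl)
  where
  b<a : b < a
  b<a = ≰⇒> a≰b
  b²≤ab : b * b ≤ b * a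
  b²≤ab = *-mono-≤ 0≤b (≤-trans 0≤b (<⇒≤ b<a)) ≤-refl (<⇒≤ b<a)
  ab<a² : b * a < a * a
  ab<a² = *-monoˡ-<-pos a {{positive (≤-<-trans 0≤b b<a)}} b<a

-- An approximation of 1/√x up to a factor 2; powers of ½ suffice.
record InvSqrt (x : ℚ) : Set where
  field
    root  : ℚ
    0<    : 0ℚ < root
    upper : root * root * x ≤ 1ℚ
    lower : 1ℚ ≤ 4ℚ * (root * root * x)

  0≤root : 0ℚ ≤ root
  0≤root = <⇒≤ 0<

  root≤1 : 1ℚ ≤ x → root ≤ 1ℚ
  root≤1 1≤x = square-cancel-≤ 0≤1 (≤-trans (0≤⇒≤ (square≥0 root ⊗ ≤⇒0≤ 1≤x) (expand root x)) upper)
    where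
    expand : ∀ r x → r * r * x - r * r ≡ r * r * (x - 1ℚ)
    expand = solve-∀ ℚ-ring

open InvSqrt

-- The root is kept while the upper bound persists and halved otherwise. The argument at most
-- doubles in one step, so one halving suffices; as r² x has then reached 1, the halved root still
-- satisfies the lower bound.
invSqrt : ∀ k → InvSqrt (ι (suc k))
invSqrt zero = record { root = 1ℚ ; 0< = positive⁻¹ 1ℚ ; upper = ≤-refl ; lower = ≤ᵇ⇒≤ _ }
invSqrt (suc k) with invSqrt k
... | record { root = r ; 0< = 0<r ; upper = up ; lower = low } with ≤-total (r * r * ι (suc (suc k))) 1ℚ
...   | inj₁ fits = record { root = r ; 0< = 0<r ; upper = fits ; lower = grow r (ι (suc k)) low }
  where
  grow : ∀ r x → 1ℚ ≤ 4ℚ * (r * r * x) → 1ℚ ≤ 4ℚ * (r * r * (1ℚ + x))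
  grow r x h = 0≤⇒≤ (≤⇒0≤ h ⊕ nonNegative⁻¹ 4ℚ ⊗ square≥0 r) (solve (r ∷ x ∷ []) ℚ-ring)
...   | inj₂ over = record
  { root  = ½ * r
  ; 0<    = positive⁻¹ (½ * r) {{pos*pos⇒pos ½ r {{positive 0<r}}}}
  ; upper = halved-upper r (ι k) (ι-nonneg k) up
  ; lower = halved-lower r (ι (suc (suc k))) over
  }
  where
  halved-upper : ∀ r x → 0ℚ ≤ x → r * r * (1ℚ + x) ≤ 1ℚ → (½ * r) * (½ * r) * (1ℚ + (1ℚ + x)) ≤ 1ℚ
  halved-upper r x 0≤x h = 0≤⇒≤ (nonNegative⁻¹ ½ ⊗ (≤⇒0≤ h ⊕ 0≤1) ⊕ nonNegative⁻¹ ¼ ⊗ (square≥0 r ⊗ 0≤x))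
    (solve (r ∷ x ∷ []) ℚ-ring)
  halved-lower : ∀ r x → 1ℚ ≤ r * r * x → 1ℚ ≤ 4ℚ * ((½ * r) * (½ * r) * x)
  halved-lower r x h = 0≤⇒≤ (≤⇒0≤ h) (solve (r ∷ x ∷ []) ℚ-ring)

-- The bound d^{3/2} K from vectors on v, N(v) and N₂(v)

𝟙-idem : ∀ b → 𝟙 b * 𝟙 b ≡ 𝟙 b
𝟙-idem true  = refl
𝟙-idem false = refl

𝟙*𝟙≤0 : ∀ a b → (a ≡ true → b ≡ true → ⊥) → 𝟙 a * 𝟙 b ≤ 0ℚ
𝟙*𝟙≤0 true  true  disjoint = ⊥-elim (disjoint refl refl)
𝟙*𝟙≤0 true  false disjoint = ≤-refl
𝟙*𝟙≤0 false b     disjoint = ≤-reflexive (*-zeroˡ (𝟙 b))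

does⇒ : ∀ {P : Set} (P? : Dec P) → does P? ≡ true → P
does⇒ (yes p) _ = p

sumL-tabulate : ∀ {A : Set} (f : A → ℚ) {k} (g : Fin k → A) → sumL f (List.tabulate g) ≡ ∑[ i < k ] f (g i)
sumL-tabulate f {zero}  g = refl
sumL-tabulate f {suc k} g = cong (λ t → f (g zero) + t) (sumL-tabulate f (λ i → g (suc i)))

sumL-++ : ∀ {A : Set} (f : A → ℚ) xs ys → sumL f (xs List.++ ys) ≡ sumL f xs + sumL f ys
sumL-++ f []       ys = sym (+-identityˡ (sumL f ys))
sumL-++ f (x ∷ xs) ys = trans (cong (λ t → f x + t) (sumL-++ f xs ys)) (sym (+-assoc (f x) (sumL f xs) (sumL f ys)))

sumL-concat : ∀ {A : Set} (f : A → ℚ) {k} (g : Fin k → List A) →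
              sumL f (List.concat (List.tabulate g)) ≡ ∑[ i < k ] sumL f (g i)
sumL-concat f {zero}  g = refl
sumL-concat f {suc k} g = trans (sumL-++ f (g zero) _) (cong (λ t → sumL f (g zero) + t) (sumL-concat f (λ i → g (suc i))))

∑²-linear : ∀ {k} a b c d (f g h i : Fin k → Fin k → ℚ) →
  ∑² (λ u w → (a * f u w + b * g u w) - (c * h u w + d * i u w)) ≡
  (a * ∑² f + b * ∑² g) - (c * ∑² h + d * ∑² i)
∑²-linear a b c d f g h i =
  trans (∑²-cong (λ u w → flatten a b c d (f u w) (g u w) (h u w) (i u w)))
    (trans (∑²-+ (λ u w → a * f u w + b * g u w) (λ u w → - c * h u w + - d * i u w))
      (trans (cong₂ _+_ (pair a b f g) (pair (- c) (- d) h i))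
        (sym (flatten a b c d (∑² f) (∑² g) (∑² h) (∑² i)))))
  where
  flatten : ∀ a b c d x y z t → (a * x + b * y) - (c * z + d * t) ≡ a * x + b * y + (- c * z + - d * t)
  flatten = solve-∀ ℚ-ring
  pair : ∀ a b f g → ∑² (λ u w → a * f u w + b * g u w) ≡ a * ∑² f + b * ∑² g
  pair a b f g = trans (∑²-+ (λ u w → a * f u w) (λ u w → b * g u w)) (cong₂ _+_ (∑²-* a f) (∑²-* b g))

module Bounds (G : Graph) (C5-free : C5Free G) (d : ℕ) (regular : ∀ v → deg G v ≡ d)
              (1≤D : 1ℚ ≤ ι d)
              (sqrtD : InvSqrt (ι d))
              (sqrtS : ∀ v → InvSqrt (C5FreeRegular.size G C5-free d regular v + ι d)) where

  open C5FreeRegular G C5-free d regular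

  δ : ℚ
  δ = root sqrtD

  ρ : V → ℚ
  ρ v = root (sqrtS v)

  σ K : ℚ
  σ = surplus G
  K = ∑[ v < n G ] ρ v

  0≤δ : 0ℚ ≤ δ
  0≤δ = 0≤root sqrtD

  0≤ρ : ∀ v → 0ℚ ≤ ρ v
  0≤ρ v = 0≤root (sqrtS v)

  δ≤1 : δ ≤ 1ℚ
  δ≤1 = root≤1 sqrtD 1≤D

  ρ≤1 : ∀ v → ρ v ≤ 1ℚ
  ρ≤1 v = root≤1 (sqrtS v) (1≤+ʳ (0≤size v) 1≤D)

  ρ²size≤1 : ∀ v → ρ v * ρ v * size v ≤ 1ℚ
  ρ²size≤1 v = ≤-trans (0≤⇒≤ (square≥0 (ρ v) ⊗ 0≤D) (expand (ρ v) (size v) D)) (upper (sqrtS v))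
    where
    expand : ∀ r s d → r * r * (s + d) - r * r * s ≡ r * r * d
    expand = solve-∀ ℚ-ring

  -- Both sides are compared after squaring and multiplying by d. This converts error terms in ρ²
  -- into the main order δ ρ.
  ρ≤2δ : ∀ v → ρ v ≤ 2ℚ * δ
  ρ≤2δ v = square-cancel-≤ (nonNegative⁻¹ 2ℚ ⊗ 0≤δ) (cancel (ρ v) δ D 1≤D (0≤size v) (upper (sqrtS v)) (lower sqrtD))
    where
    cancel : ∀ r δ d {s} → 1ℚ ≤ d → 0ℚ ≤ s → r * r * (s + d) ≤ 1ℚ → 1ℚ ≤ 4ℚ * (δ * δ * d) → r * r ≤ (2ℚ * δ) * (2ℚ * δ)
    cancel r δ d {s} 1≤d 0≤s up low =
      *-cancelʳ-≤-pos d {{positive (<-≤-trans (positive⁻¹ 1ℚ) 1≤d)}}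
        (0≤⇒≤ (≤⇒0≤ up ⊕ ≤⇒0≤ low ⊕ square≥0 r ⊗ 0≤s) (solve (r ∷ δ ∷ d ∷ s ∷ []) ℚ-ring))

  module FirstBound (ε : ℚ) (0≤ε : 0ℚ ≤ ε) (ε-small : ℤ.+ 1048576 / 1 * (ε * ε) ≤ ⅛) where

    coordinate : V → Coordinate
    coordinate w = record
      { pos   = λ v → 512ℚ * ε * I v w + ε * ρ v * N v w
      ; neg   = λ v → 32ℚ * ε * δ * E v w
      ; 0≤pos = λ v → nonNegative⁻¹ 512ℚ ⊗ 0≤ε ⊗ 0≤I v w ⊕ 0≤ε ⊗ 0≤ρ v ⊗ 0≤N v w
      ; 0≤neg = λ v → nonNegative⁻¹ 32ℚ ⊗ 0≤ε ⊗ 0≤δ ⊗ 0≤E v w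
      }

    L : List Coordinate
    L = List.tabulate coordinate

    norms : ∀ v → sumL (norm v) L ≤ ⅛
    norms v = begin
      sumL (norm v) L
        ≡⟨ sumL-tabulate (norm v) coordinate ⟩
      ∑[ w < n G ] (norm v (coordinate w))                                 ≤⟨ sum-mono pointwise ⟩
      ∑[ w < n G ] (x * I v w + (y * N v w + z * E v w))
        ≡⟨ ∑-distrib-+ (λ w → x * I v w) (λ w → y * N v w + z * E v w) ⟩
      ∑[ w < n G ] (x * I v w) + ∑[ w < n G ] (y * N v w + z * E v w)
        ≡⟨ cong₂ _+_ (sum-const-* x (I v)) (∑-distrib-+ (λ w → y * N v w) (λ w → z * E v w)) ⟩
      x * sum (I v) + (∑[ w < n G ] (y * N v w) + ∑[ w < n G ] (z * E v w))
        ≡⟨ cong₂ (λ s t → x * sum (I v) + (s + t)) (sum-const-* y (N v)) (sum-const-* z (E v)) ⟩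
      x * sum (I v) + (y * size v + z * sum (E v))
        ≡⟨ cong₂ (λ s t → x * s + (y * size v + z * t)) (sum-δ v) (∑E≡D v) ⟩
      x * 1ℚ + (y * size v + z * D)
        ≤⟨ total ε (ρ v) δ (size v) D (ρ²size≤1 v) (upper sqrtD) ε-small ⟩
      ⅛                                                                  ∎
      where
      open ≤-Reasoning
      x y z : ℚ
      x = 2ℚ * (512ℚ * ε) * (512ℚ * ε)
      y = 2ℚ * (ε * ρ v) * (ε * ρ v)
      z = (32ℚ * ε * δ) * (32ℚ * ε * δ)
      total : ∀ ε r δ s d → r * r * s ≤ 1ℚ → δ * δ * d ≤ 1ℚ → ℤ.+ 1048576 / 1 * (ε * ε) ≤ ⅛ →
        2ℚ * (512ℚ * ε) * (512ℚ * ε) * 1ℚ +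
        (2ℚ * (ε * r) * (ε * r) * s + (32ℚ * ε * δ) * (32ℚ * ε * δ) * d) ≤ ⅛
      -- The slack is 523262 = 2²⁰ - 2 · 512² - 2 - 32².
      total ε r δ s d h₁ h₂ h₃ = 0≤⇒≤
        (≤⇒0≤ h₃ ⊕ nonNegative⁻¹ 2ℚ ⊗ (square≥0 ε ⊗ ≤⇒0≤ h₁) ⊕ nonNegative⁻¹ (ℤ.+ 1024 / 1) ⊗ (square≥0 ε ⊗ ≤⇒0≤ h₂) ⊕
          nonNegative⁻¹ (ℤ.+ 523262 / 1) ⊗ square≥0 ε)
        (expand ε r δ s d)
        where
        expand : ∀ ε r δ s d →
          ⅛ - (2ℚ * (512ℚ * ε) * (512ℚ * ε) * 1ℚ + (2ℚ * (ε * r) * (ε * r) * s + (32ℚ * ε * δ) * (32ℚ * ε * δ) * d)) ≡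
          ⅛ - ℤ.+ 1048576 / 1 * (ε * ε) + 2ℚ * (ε * ε * (1ℚ - r * r * s)) +
          ℤ.+ 1024 / 1 * (ε * ε * (1ℚ - δ * δ * d)) + ℤ.+ 523262 / 1 * (ε * ε)
        expand = solve-∀ ℚ-ring
      bound : ∀ a c b i k l → i * i ≡ i → k * k ≡ k → l * l ≡ l →
        (a * i + c * k) * (a * i + c * k) + (b * l) * (b * l) ≤ 2ℚ * a * a * i + (2ℚ * c * c * k + b * b * l)
      bound a c b i k l i²≡i k²≡k l²≡l = subst₂ (λ s t → (a * i + c * k) * (a * i + c * k) + (b * l) * (b * l) ≤ 2ℚ * a * a * s + t) i²≡i
        (cong₂ (λ s t → 2ℚ * c * c * s + b * b * t) k²≡k l²≡l)
        (0≤⇒≤ (square≥0 (a * i - c * k)) (expand a c b i k l))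
        where
        expand : ∀ a c b i k l → 2ℚ * a * a * (i * i) + (2ℚ * c * c * (k * k) + b * b * (l * l)) -
          ((a * i + c * k) * (a * i + c * k) + (b * l) * (b * l)) ≡ (a * i - c * k) * (a * i - c * k)
        expand = solve-∀ ℚ-ring
      pointwise : ∀ w → norm v (coordinate w) ≤ x * I v w + (y * N v w + z * E v w)
      pointwise w = bound (512ℚ * ε) (ε * ρ v) (32ℚ * ε * δ) (I v w) (N v w) (E v w)
        (𝟙-idem (does (v ≟ w))) (𝟙-idem (second v w)) (𝟙-idem (adj G v w))

    -- The part of the gain attributed to v as an end of the edge v ∼ u.
    share : V → V → V → ℚ
    share v u w =
      ((512ℚ * ε) * (32ℚ * ε * δ) * (I v w * E u w) + (32ℚ * ε * δ) * (ε * ρ v) * (E u w * N v w)) -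
      (2ℚ * (32ℚ * ε * δ) * (32ℚ * ε * δ) * (E v w * E u w) + 2ℚ * (ε * ρ v) * (ε * ρ v) * (N u w * N v w))

    -- For adjacent u and v the products of positive parts involving `I` vanish: the vertices differ
    -- and neither lies in the other's second neighbourhood. Only N₂ against N₂ survives, and 2 c c′
    -- ≤ c² + c′² divides its cost between the two ends.
    share≤gain : ∀ u v → u ~ v → ∀ w → share v u w + share u v w ≤ gain (coordinate w) u v
    share≤gain u v u~v w = lemma (512ℚ * ε) (32ℚ * ε * δ) (ε * ρ u) (ε * ρ v) (I u w) (I v w) (N u w) (N v w) (E u w) (E v w)
      (nonNegative⁻¹ 512ℚ ⊗ 0≤ε) (0≤ε ⊗ 0≤ρ u) (0≤ε ⊗ 0≤ρ v) (0≤N u w) (0≤N v w)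
      (𝟙*𝟙≤0 (does (u ≟ w)) (does (v ≟ w)) λ u≡w v≡w → ~⇒≢ u~v (trans (does⇒ (u ≟ w) u≡w) (sym (does⇒ (v ≟ w) v≡w))))
      (𝟙*𝟙≤0 (does (u ≟ w)) (second v w) λ u≡w vw → separated-by (does⇒ (u ≟ w) u≡w) vw u~v)
      (𝟙*𝟙≤0 (does (v ≟ w)) (second u w) λ v≡w uw → separated-by (does⇒ (v ≟ w) v≡w) uw (~-sym u~v))
      where
      separated-by : ∀ {x y} → x ≡ w → second y w ≡ true → x ~ y → ⊥
      separated-by refl yw x~y = second⇒≁ yw (~-sym x~y)
      lemma : ∀ a b c c′ i i′ k k′ l l′ → 0ℚ ≤ a → 0ℚ ≤ c → 0ℚ ≤ c′ → 0ℚ ≤ k → 0ℚ ≤ k′ →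
        i * i′ ≤ 0ℚ → i * k′ ≤ 0ℚ → i′ * k ≤ 0ℚ →
        ((a * b * (i′ * l) + b * c′ * (l * k′)) - (2ℚ * b * b * (l′ * l) + 2ℚ * c′ * c′ * (k * k′))) +
        ((a * b * (i * l′) + b * c * (l′ * k)) - (2ℚ * b * b * (l * l′) + 2ℚ * c * c * (k′ * k))) ≤
        (a * i + c * k) * (b * l′) + b * l * (a * i′ + c′ * k′) -
        4ℚ * ((a * i + c * k) * (a * i′ + c′ * k′) + b * l * (b * l′))
      lemma a b c c′ i i′ k k′ l l′ 0≤a 0≤c 0≤c′ 0≤k 0≤k′ h₁ h₂ h₃ = 0≤⇒≤
        (nonNegative⁻¹ 4ℚ ⊗ (square≥0 a ⊗ ≤⇒0≤ h₁ ⊕ 0≤a ⊗ (0≤c′ ⊗ ≤⇒0≤ h₂ ⊕ 0≤c ⊗ ≤⇒0≤ h₃)) ⊕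
         nonNegative⁻¹ 2ℚ ⊗ (square≥0 (c - c′) ⊗ (0≤k ⊗ 0≤k′)))
        (expand a b c c′ i i′ k k′ l l′)
        where
        expand : ∀ a b c c′ i i′ k k′ l l′ →
          (a * i + c * k) * (b * l′) + b * l * (a * i′ + c′ * k′) -
          4ℚ * ((a * i + c * k) * (a * i′ + c′ * k′) + b * l * (b * l′)) -
          (((a * b * (i′ * l) + b * c′ * (l * k′)) - (2ℚ * b * b * (l′ * l) + 2ℚ * c′ * c′ * (k * k′))) +
           ((a * b * (i * l′) + b * c * (l′ * k)) - (2ℚ * b * b * (l * l′) + 2ℚ * c * c * (k′ * k)))) ≡
          4ℚ * (a * a * (0ℚ - i * i′) + a * (c′ * (0ℚ - i * k′) + c * (0ℚ - i′ * k))) +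
          2ℚ * ((c - c′) * (c - c′) * (k * k′))
        expand = solve-∀ ℚ-ring

    ∑share : ∀ v → 16ℚ * (ε * ε) * (δ * (D * D) * ρ v) ≤ ∑² (λ u w → E v u * share v u w)
    ∑share v = begin
      16ℚ * (ε * ε) * (δ * (D * D) * ρ v)
        ≤⟨ numeric ε δ (ρ v) D (paths v) (triangles v) (overlaps v) 0≤ε 0≤δ (0≤ρ v) 0≤D δ≤1 (ρ≤1 v) (ρ≤2δ v) (D²≤5D+paths v) (triangles≤4D v) (overlaps≤4D² v) ⟩
      (x * D + y * paths v) - (z * triangles v + t * overlaps v)
        ≤⟨ +-monoˡ-≤ (- (z * triangles v + t * overlaps v)) (+-monoˡ-≤ (y * paths v) (*-mono-≤ 0≤x (≤-trans 0≤D D≤self) ≤-refl D≤self)) ⟩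
      (x * ∑² self + y * paths v) - (z * triangles v + t * overlaps v)
        ≡⟨ ∑²-linear x y z t self path tri over ⟨
      ∑² (λ u w → (x * self u w + y * path u w) - (z * tri u w + t * over u w))
        ≡⟨ ∑²-cong (λ u w → factor x y z t (E v u) (I v w * E u w) (E u w * N v w) (E v w * E u w) (N u w * N v w)) ⟩
      ∑² (λ u w → E v u * share v u w) ∎
      where
      open ≤-Reasoning
      x y z t : ℚ
      x = (512ℚ * ε) * (32ℚ * ε * δ)
      y = (32ℚ * ε * δ) * (ε * ρ v)
      z = 2ℚ * (32ℚ * ε * δ) * (32ℚ * ε * δ)
      t = 2ℚ * (ε * ρ v) * (ε * ρ v)
      0≤x : 0ℚ ≤ x
      0≤x = (nonNegative⁻¹ 512ℚ ⊗ 0≤ε) ⊗ (nonNegative⁻¹ 32ℚ ⊗ 0≤ε ⊗ 0≤δ)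
      self path tri over : V → V → ℚ
      self u w = E v u * (I v w * E u w)
      path u w = E v u * (E u w * N v w)
      tri  u w = E v u * (E v w * E u w)
      over u w = E v u * (N u w * N v w)
      factor : ∀ x y z t e a b c d → (x * (e * a) + y * (e * b)) - (z * (e * c) + t * (e * d)) ≡ e * ((x * a + y * b) - (z * c + t * d))
      factor = solve-∀ ℚ-ring
      D≤self : D ≤ ∑² self
      D≤self = ≤-trans (≤-reflexive (trans (sym (*-identityʳ D)) (sym (∑E* v 1ℚ)))) (sum-mono row)
        where
        row : ∀ u → E v u * 1ℚ ≤ ∑[ w < n G ] self u w
        row u = ≤-trans (𝟙*-mono return) (≤-reflexive (sym (sum-const-* (E v u) (λ w → I v w * E u w))))
          where
          return : v ~ u → 1ℚ ≤ ∑[ w < n G ] (I v w * E u w)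
          return v~u = ≤-trans (≤-reflexive (sym (cong₂ _*_ (cong 𝟙 (dec-true (v ≟ v) refl)) (E≡1 (~-sym v~u)))))
            (term≤sum (λ w → 0≤I v w ⊗ 0≤E u w) v)
      -- In units of ε², the walks into N₂(v) give 32 δ r d², up to 160 δ r d. Overlaps cost at most
      -- 8 r² d² ≤ 16 δ r d², leaving 16. The linear losses, 160 δ r d and 8192 δ² d from triangles,
      -- are covered by 512 · 32 δ d from the returning walks; this dictates the ratios 512 : 32 :
      -- 1.
      numeric : ∀ ε δ r d p q o → 0ℚ ≤ ε → 0ℚ ≤ δ → 0ℚ ≤ r → 0ℚ ≤ d → δ ≤ 1ℚ → r ≤ 1ℚ → r ≤ 2ℚ * δ →
        d * d ≤ ℤ.+ 5 / 1 * d + p → q ≤ 4ℚ * d → o ≤ 4ℚ * (d * d) →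
        16ℚ * (ε * ε) * (δ * (d * d) * r) ≤
        ((512ℚ * ε) * (32ℚ * ε * δ) * d + (32ℚ * ε * δ) * (ε * r) * p) -
        (2ℚ * (32ℚ * ε * δ) * (32ℚ * ε * δ) * q + 2ℚ * (ε * r) * (ε * r) * o)
      numeric ε δ r d p q o 0≤ε 0≤δ 0≤r 0≤d δ≤1 r≤1 r≤2δ hp hq ho = 0≤⇒≤
        (square≥0 ε ⊗ (nonNegative⁻¹ 32ℚ ⊗ (0≤δ ⊗ 0≤r ⊗ ≤⇒0≤ hp) ⊕
          nonNegative⁻¹ (ℤ.+ 2048 / 1) ⊗ (square≥0 δ ⊗ ≤⇒0≤ hq) ⊕
          nonNegative⁻¹ 2ℚ ⊗ (square≥0 r ⊗ ≤⇒0≤ ho) ⊕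
          nonNegative⁻¹ 8ℚ ⊗ (0≤r ⊗ square≥0 d ⊗ ≤⇒0≤ r≤2δ) ⊕
          0≤δ ⊗ 0≤d ⊗ (nonNegative⁻¹ (ℤ.+ 8032 / 1) ⊕ nonNegative⁻¹ (ℤ.+ 160 / 1) ⊗ ≤⇒0≤ r≤1 ⊕
            nonNegative⁻¹ (ℤ.+ 8192 / 1) ⊗ ≤⇒0≤ δ≤1)))
        (expand ε δ r d p q o)
        where
        expand : ∀ ε δ r d p q o →
          (512ℚ * ε) * (32ℚ * ε * δ) * d + (32ℚ * ε * δ) * (ε * r) * p -
          (2ℚ * (32ℚ * ε * δ) * (32ℚ * ε * δ) * q + 2ℚ * (ε * r) * (ε * r) * o) -
          16ℚ * (ε * ε) * (δ * (d * d) * r) ≡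
          ε * ε * (32ℚ * (δ * r * (ℤ.+ 5 / 1 * d + p - d * d)) +
            ℤ.+ 2048 / 1 * (δ * δ * (4ℚ * d - q)) +
            2ℚ * (r * r * (4ℚ * (d * d) - o)) +
            8ℚ * (r * (d * d) * (2ℚ * δ - r)) +
            δ * d * (ℤ.+ 8032 / 1 + ℤ.+ 160 / 1 * (1ℚ - r) + ℤ.+ 8192 / 1 * (1ℚ - δ)))
        expand = solve-∀ ℚ-ring

    first-bound : 32ℚ * (ε * ε) * (δ * (D * D) * K) ≤ 8ℚ * σ
    first-bound = begin
      32ℚ * (ε * ε) * (δ * (D * D) * K) ≡⟨ double (ε * ε) (δ * (D * D)) K ⟩
      half + half ≤⟨ +-mono-≤ half≤ half≤ ⟩
      ∑³ (λ v u w → E v u * share v u w) + ∑³ (λ v u w → E v u * share v u w)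
        ≡⟨ cong (λ t → t + ∑³ (λ v u w → E v u * share v u w)) swap ⟩
      ∑³ (λ u v w → E u v * share v u w) + ∑³ (λ u v w → E u v * share u v w)
        ≡⟨ sym (∑²-+ (λ u v → ∑[ w < n G ] (E u v * share v u w)) (λ u v → ∑[ w < n G ] (E u v * share u v w))) ⟩
      ∑² (λ u v → ∑[ w < n G ] (E u v * share v u w) + ∑[ w < n G ] (E u v * share u v w))
        ≤⟨ ∑²-mono pointwise ⟩
      ∑² (λ u v → E u v * sumL (λ s → gain s u v) L) ≤⟨ cut-rounding G L norms ⟩
      8ℚ * σ ∎
      where
      open ≤-Reasoning
      ∑³ : (V → V → V → ℚ) → ℚ
      ∑³ f = ∑² (λ u v → ∑[ w < n G ] f u v w)
      half : ℚ
      half = 16ℚ * (ε * ε) * (δ * (D * D)) * K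
      double : ∀ e x k → 32ℚ * e * (x * k) ≡ 16ℚ * e * x * k + 16ℚ * e * x * k
      double = solve-∀ ℚ-ring
      half≤ : half ≤ ∑³ (λ v u w → E v u * share v u w)
      half≤ = ≤-trans (≤-reflexive (sym (sum-const-* (16ℚ * (ε * ε) * (δ * (D * D))) ρ)))
        (sum-mono (λ v → ≤-trans (≤-reflexive (assoc (16ℚ * (ε * ε)) (δ * (D * D)) (ρ v))) (∑share v)))
        where
        assoc : ∀ a b c → a * b * c ≡ a * (b * c)
        assoc = solve-∀ ℚ-ring
      swap : ∑³ (λ v u w → E v u * share v u w) ≡ ∑³ (λ u v w → E u v * share v u w)
      swap = trans (∑-comm (λ v u → ∑[ w < n G ] (E v u * share v u w)))
        (∑²-cong λ u v → sum-cong-≗ λ w → cong (λ t → t * share v u w) (E-sym v u))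
      pointwise : ∀ u v → ∑[ w < n G ] (E u v * share v u w) + ∑[ w < n G ] (E u v * share u v w) ≤
                          E u v * sumL (λ s → gain s u v) L
      pointwise u v = begin
        ∑[ w < n G ] (E u v * share v u w) + ∑[ w < n G ] (E u v * share u v w)
          ≡⟨ cong₂ _+_ (sum-const-* (E u v) (share v u)) (sum-const-* (E u v) (share u v)) ⟩
        E u v * sum (share v u) + E u v * sum (share u v)
          ≡⟨ *-distribˡ-+ (E u v) (sum (share v u)) (sum (share u v)) ⟨
        E u v * (sum (share v u) + sum (share u v)) ≤⟨ 𝟙*-mono {adj G u v} gains ⟩
        E u v * sumL (λ s → gain s u v) L ∎
        where
        gains : u ~ v → sum (share v u) + sum (share u v) ≤ sumL (λ s → gain s u v) L
        gains u~v = begin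
          sum (share v u) + sum (share u v) ≡⟨ ∑-distrib-+ (share v u) (share u v) ⟨
          ∑[ w < n G ] (share v u w + share u v w) ≤⟨ sum-mono (share≤gain u v u~v) ⟩
          ∑[ w < n G ] (gain (coordinate w) u v) ≡⟨ sumL-tabulate (λ s → gain s u v) coordinate ⟨
          sumL (λ s → gain s u v) L ∎

-- The bound H / n from centred second neighbourhoods

∑²-first : ∀ {k} (f : Fin k → ℚ) → ∑² (λ u w → f u) ≡ ι k * sum f
∑²-first {k} f = trans (sum-cong-≗ (λ u → sum-const k (f u))) (sum-const-* (ι k) f)

∑²-second : ∀ {k} (f : Fin k → ℚ) → ∑² (λ u w → f w) ≡ ι k * sum f
∑²-second {k} f = sum-const k (sum f)

∑²-product : ∀ {k} (f g : Fin k → ℚ) → ∑² (λ u w → f u * g w) ≡ sum f * sum g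
∑²-product f g = trans (sum-cong-≗ (λ u → sum-const-* (f u) g)) (sym (*-distribʳ-sum (sum g) f))

module SecondBound (G : Graph) (C5-free : C5Free G) (d : ℕ) (regular : ∀ v → deg G v ≡ d)
              (1≤D : 1ℚ ≤ ι d)
              (sqrtD : InvSqrt (ι d))
              (sqrtS : ∀ v → InvSqrt (C5FreeRegular.size G C5-free d regular v + ι d))
              (sqrtn : InvSqrt (ι (n G))) where

  open C5FreeRegular G C5-free d regular
  open Bounds G C5-free d regular 1≤D sqrtD sqrtS

  ν : ℚ
  ν = InvSqrt.root sqrtn

  0≤ν : 0ℚ ≤ ν
  0≤ν = InvSqrt.0≤root sqrtn

  -- The squared norm at v, summed over all pairs, is 2 n θ² |N₂(v)|. As ν² n and ρ² |N₂(v)| are at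
  -- most 1, the factor ¼ brings it down to ⅛.
  θ : V → ℚ
  θ v = ¼ * ν * ρ v

  0≤θ : ∀ v → 0ℚ ≤ θ v
  0≤θ v = nonNegative⁻¹ ¼ ⊗ 0≤ν ⊗ 0≤ρ v

  -- Summing over all pairs (w, w′) realises the projection orthogonal to the constants,
  -- with the positive and negative contributions in separate coordinates.
  difference : V → V → Coordinate
  difference w w′ = record
    { pos   = λ v → θ v * N v w
    ; neg   = λ v → θ v * N v w′
    ; 0≤pos = λ v → 0≤θ v ⊗ 0≤N v w
    ; 0≤neg = λ v → 0≤θ v ⊗ 0≤N v w′
    }

  differences : List Coordinate
  differences = List.concat (List.tabulate λ w → List.tabulate (difference w))

  sumL-differences : ∀ f → sumL f differences ≡ ∑² (λ w w′ → f (difference w w′))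
  sumL-differences f = trans (sumL-concat f (λ w → List.tabulate (difference w)))
    (sum-cong-≗ λ w → sumL-tabulate f (difference w))

  norms : ∀ v → sumL (norm v) differences ≤ ⅛
  norms v = begin
    sumL (norm v) differences                             ≡⟨ sumL-differences (norm v) ⟩
    ∑² (λ w w′ → norm v (difference w w′))
      ≡⟨ ∑²-cong (λ w w′ → squares (θ v) (N v w) (N v w′) (𝟙-idem (second v w)) (𝟙-idem (second v w′))) ⟩
    ∑² (λ w w′ → θ v * θ v * (N v w + N v w′))            ≡⟨ ∑²-* (θ v * θ v) (λ w w′ → N v w + N v w′) ⟩
    θ v * θ v * ∑² (λ w w′ → N v w + N v w′)
      ≡⟨ cong (λ t → θ v * θ v * t) (trans (∑²-+ (λ w w′ → N v w) (λ w w′ → N v w′)) (cong₂ _+_ (∑²-first (N v)) (∑²-second (N v)))) ⟩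
    θ v * θ v * (∣V∣ * size v + ∣V∣ * size v)
      ≤⟨ total ν (ρ v) (size v) ∣V∣ (0≤size v) (InvSqrt.upper sqrtn) (ρ²size≤1 v) ⟩
    ⅛                                                     ∎
    where
    open ≤-Reasoning
    squares : ∀ t x y → x * x ≡ x → y * y ≡ y → t * x * (t * x) + t * y * (t * y) ≡ t * t * (x + y)
    squares t x y x²≡x y²≡y = trans (expand t x y) (cong₂ (λ a b → t * t * (a + b)) x²≡x y²≡y)
      where
      expand : ∀ t x y → t * x * (t * x) + t * y * (t * y) ≡ t * t * (x * x + y * y)
      expand = solve-∀ ℚ-ring
    total : ∀ ν r s m → 0ℚ ≤ s → ν * ν * m ≤ 1ℚ → r * r * s ≤ 1ℚ →
            ¼ * ν * r * (¼ * ν * r) * (m * s + m * s) ≤ ⅛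
    total ν r s m 0≤s h₁ h₂ = 0≤⇒≤ (nonNegative⁻¹ ⅛ ⊗ (≤⇒0≤ h₂ ⊕ square≥0 r ⊗ 0≤s ⊗ ≤⇒0≤ h₁)) (expand ν r s m)
      where
      expand : ∀ ν r s m → ⅛ - ¼ * ν * r * (¼ * ν * r) * (m * s + m * s) ≡
        ⅛ * (1ℚ - r * r * s + r * r * s * (1ℚ - ν * ν * m))
      expand = solve-∀ ℚ-ring

  common : V → V → ℚ
  common u v = ∑[ w < n G ] (N u w * N v w)

  0≤common : ∀ u v → 0ℚ ≤ common u v
  0≤common u v = sum-nonneg (λ w → 0≤N u w ⊗ 0≤N v w)

  common-sym : ∀ u v → common u v ≡ common v u
  common-sym u v = sum-cong-≗ (λ w → *-comm (N u w) (N v w))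

  -- A stand-in for 1/ρ without division: `ρ v * h v` is at most 1, and at least 1/12 once the
  -- degree is at least 10.
  h : V → ℚ
  h v = ρ v * size v

  penalty : V → V → ℚ
  penalty u v = ρ u * ρ u * (E u v * common v u)

  -- The sum over (w, w′) has mixed part 2 |N₂(u)| |N₂(v)|, which is the gain, and like part 2 n
  -- |N₂(u) ∩ N₂(v)|, weighted by 4. In the latter ν² n ≤ 1 removes n, and 2 ρ_u ρ_v ≤ ρ_u² + ρ_v²
  -- splits the cost between the ends.
  gains≥ : ∀ u v → (¼ * ¼ * (ν * ν) * (E u v * (h u * h v)) + ¼ * ¼ * (ν * ν) * (E u v * (h u * h v))) -
                   (¼ * penalty u v + ¼ * penalty v u) ≤
                   E u v * sumL (λ s → gain s u v) differences
  gains≥ u v = begin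
    (x * (E u v * (h u * h v)) + x * (E u v * (h u * h v))) - (¼ * penalty u v + ¼ * penalty v u)
      ≡⟨ cong₂ (λ a b → (x * (E u v * (h u * h v)) + x * (E u v * (h u * h v))) - (¼ * (ρ u * ρ u * (E u v * a)) + ¼ * (ρ v * ρ v * (b * common u v))))
           (common-sym v u) (E-sym v u) ⟩
    (x * (E u v * (h u * h v)) + x * (E u v * (h u * h v))) -
      (¼ * (ρ u * ρ u * (E u v * common u v)) + ¼ * (ρ v * ρ v * (E u v * common u v)))
      ≤⟨ lemma (E u v) ν (ρ u) (ρ v) (size u) (size v) (common u v) ∣V∣ (0≤E u v) (0≤common u v) (ι-nonneg (n G)) (InvSqrt.upper sqrtn) ⟩
    E u v * ((θ u * θ v * (size u * size v) + θ u * θ v * (size u * size v)) -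
             (4ℚ * (θ u * θ v) * (∣V∣ * common u v) + 4ℚ * (θ u * θ v) * (∣V∣ * common u v)))
      ≡⟨ cong (λ t → E u v * t) (sym gains) ⟩
    E u v * sumL (λ s → gain s u v) differences ∎
    where
    open ≤-Reasoning
    x : ℚ
    x = ¼ * ¼ * (ν * ν)
    lemma : ∀ e ν r r′ s s′ c m → 0ℚ ≤ e → 0ℚ ≤ c → 0ℚ ≤ m → ν * ν * m ≤ 1ℚ →
      (¼ * ¼ * (ν * ν) * (e * (r * s * (r′ * s′))) + ¼ * ¼ * (ν * ν) * (e * (r * s * (r′ * s′)))) -
        (¼ * (r * r * (e * c)) + ¼ * (r′ * r′ * (e * c))) ≤
      e * ((¼ * ν * r * (¼ * ν * r′) * (s * s′) + ¼ * ν * r * (¼ * ν * r′) * (s * s′)) -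
           (4ℚ * (¼ * ν * r * (¼ * ν * r′)) * (m * c) + 4ℚ * (¼ * ν * r * (¼ * ν * r′)) * (m * c)))
    lemma e ν r r′ s s′ c m 0≤e 0≤c 0≤m h = 0≤⇒≤
      (0≤e ⊗ 0≤c ⊗ (nonNegative⁻¹ ¼ ⊗ ((square≥0 r ⊕ square≥0 r′) ⊗ ≤⇒0≤ h ⊕ square≥0 ν ⊗ 0≤m ⊗ square≥0 (r - r′))))
      (expand e ν r r′ s s′ c m)
      where
      expand : ∀ e ν r r′ s s′ c m →
        e * ((¼ * ν * r * (¼ * ν * r′) * (s * s′) + ¼ * ν * r * (¼ * ν * r′) * (s * s′)) -
           (4ℚ * (¼ * ν * r * (¼ * ν * r′)) * (m * c) + 4ℚ * (¼ * ν * r * (¼ * ν * r′)) * (m * c))) -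
        ((¼ * ¼ * (ν * ν) * (e * (r * s * (r′ * s′))) + ¼ * ¼ * (ν * ν) * (e * (r * s * (r′ * s′)))) -
        (¼ * (r * r * (e * c)) + ¼ * (r′ * r′ * (e * c)))) ≡
        e * c * (¼ * ((r * r + r′ * r′) * (1ℚ - ν * ν * m) + ν * ν * m * ((r - r′) * (r - r′))))
      expand = solve-∀ ℚ-ring
    gains : sumL (λ s → gain s u v) differences ≡
      (θ u * θ v * (size u * size v) + θ u * θ v * (size u * size v)) -
      (4ℚ * (θ u * θ v) * (∣V∣ * common u v) + 4ℚ * (θ u * θ v) * (∣V∣ * common u v))
    gains = trans (sumL-differences (λ s → gain s u v))
      (trans (∑²-cong λ w w′ → regroup (θ u) (θ v) (N u w) (N u w′) (N v w) (N v w′))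
        (trans (∑²-linear (θ u * θ v) (θ u * θ v) (4ℚ * (θ u * θ v)) (4ℚ * (θ u * θ v))
                 (λ w w′ → N u w * N v w′) (λ w w′ → N u w′ * N v w) (λ w w′ → N u w * N v w) (λ w w′ → N u w′ * N v w′))
          (cong₂ _-_
            (cong₂ (λ a b → θ u * θ v * a + θ u * θ v * b) (∑²-product (N u) (N v))
              (trans (∑-comm (λ w w′ → N u w′ * N v w)) (∑²-product (N u) (N v))))
            (cong₂ (λ a b → 4ℚ * (θ u * θ v) * a + 4ℚ * (θ u * θ v) * b) (∑²-first (λ w → N u w * N v w)) (∑²-second (λ w → N u w * N v w))))))
      where
      regroup : ∀ t t′ a a′ b b′ → t * a * (t′ * b′) + t * a′ * (t′ * b) - 4ℚ * (t * a * (t′ * b) + t * a′ * (t′ * b′)) ≡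
        (t * t′ * (a * b′) + t * t′ * (a′ * b)) - (4ℚ * (t * t′) * (a * b) + 4ℚ * (t * t′) * (a′ * b′))
      regroup = solve-∀ ℚ-ring

  H : ℚ
  H = ∑² (λ u v → E u v * (h u * h v))

  -- The penalties of one vertex add up to ρ² times its overlaps. Trading one ρ for 2 δ makes them a
  -- multiple of the quantity that the first bound already controls.
  ∑penalty : ∑² penalty ≤ 8ℚ * (δ * (D * D) * K)
  ∑penalty = begin
    ∑² penalty
      ≡⟨ sum-cong-≗ (λ u → trans (sum-const-* (ρ u * ρ u) (λ v → E u v * common v u)) (cong (λ t → ρ u * ρ u * t) (row u))) ⟩
    ∑[ u < n G ] (ρ u * ρ u * overlaps u)
      ≤⟨ sum-mono (λ u → bound (ρ u) δ D (overlaps u) (0≤ρ u) (ρ≤2δ u) (overlaps≤4D² u)) ⟩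
    ∑[ u < n G ] (8ℚ * (δ * (D * D)) * ρ u)      ≡⟨ sum-const-* (8ℚ * (δ * (D * D))) ρ ⟩
    8ℚ * (δ * (D * D)) * K                       ≡⟨ *-assoc 8ℚ (δ * (D * D)) K ⟩
    8ℚ * (δ * (D * D) * K)                       ∎
    where
    open ≤-Reasoning
    row : ∀ u → ∑[ v < n G ] (E u v * common v u) ≡ overlaps u
    row u = sum-cong-≗ λ v → sym (sum-const-* (E u v) (λ w → N v w * N u w))
    bound : ∀ r δ d o → 0ℚ ≤ r → r ≤ 2ℚ * δ → o ≤ 4ℚ * (d * d) → r * r * o ≤ 8ℚ * (δ * (d * d)) * r
    bound r δ d o 0≤r h₁ h₂ = 0≤⇒≤ (square≥0 r ⊗ ≤⇒0≤ h₂ ⊕ nonNegative⁻¹ 4ℚ ⊗ (square≥0 d ⊗ 0≤r ⊗ ≤⇒0≤ h₁)) (expand r δ d o)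
      where
      expand : ∀ r δ d o → 8ℚ * (δ * (d * d)) * r - r * r * o ≡ r * r * (4ℚ * (d * d) - o) + 4ℚ * (d * d * r * (2ℚ * δ - r))
      expand = solve-∀ ℚ-ring

  second-bound : ν * ν * H ≤ 8ℚ * (8ℚ * σ) + 32ℚ * (δ * (D * D) * K)
  second-bound = finish (ν * ν) H (∑² penalty) (δ * (D * D) * K) (8ℚ * σ) ∑penalty (begin
    (x * H + x * H) - (¼ * ∑² penalty + ¼ * ∑² penalty)
      ≡⟨ cong (λ t → (x * H + x * H) - (¼ * ∑² penalty + ¼ * t)) (∑-comm penalty) ⟩
    (x * H + x * H) - (¼ * ∑² penalty + ¼ * ∑² (λ u v → penalty v u))
      ≡⟨ ∑²-linear x x ¼ ¼ (λ u v → E u v * (h u * h v)) (λ u v → E u v * (h u * h v)) penalty (λ u v → penalty v u) ⟨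
    ∑² (λ u v → (x * (E u v * (h u * h v)) + x * (E u v * (h u * h v))) - (¼ * penalty u v + ¼ * penalty v u))
      ≤⟨ ∑²-mono gains≥ ⟩
    ∑² (λ u v → E u v * sumL (λ s → gain s u v) differences)
      ≤⟨ cut-rounding G differences norms ⟩
    8ℚ * σ ∎)
    where
    open ≤-Reasoning
    x : ℚ
    x = ¼ * ¼ * (ν * ν)
    finish : ∀ y a p b s → p ≤ 8ℚ * b → (¼ * ¼ * y * a + ¼ * ¼ * y * a) - (¼ * p + ¼ * p) ≤ s → y * a ≤ 8ℚ * s + 32ℚ * b
    finish y a p b s h₁ h₂ = 0≤⇒≤ (nonNegative⁻¹ 8ℚ ⊗ ≤⇒0≤ h₂ ⊕ nonNegative⁻¹ 4ℚ ⊗ ≤⇒0≤ h₁) (expand y a p b s)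
      where
      expand : ∀ y a p b s → 8ℚ * s + 32ℚ * b - y * a ≡
        8ℚ * (s - ((¼ * ¼ * y * a + ¼ * ¼ * y * a) - (¼ * p + ¼ * p))) + 4ℚ * (8ℚ * b - p)
      expand = solve-∀ ℚ-ring

-- Naturals inside ℚ, powers, and the elimination of K and H

sum-𝟙-ℕ : ∀ {k} (P : Fin k → Bool) → ∃ λ s → ∑[ i < k ] 𝟙 (P i) ≡ ι s
sum-𝟙-ℕ {zero}  P = 0 , refl
sum-𝟙-ℕ {suc k} P with P zero | sum-𝟙-ℕ (λ i → P (suc i))
... | true  | s , eq = suc s , cong (λ t → 1ℚ + t) eq
... | false | s , eq = s , trans (+-identityˡ _) eq

inverse : ∀ {x} → 0ℚ < x → ∃ λ y → 0ℚ ≤ y × x * y ≡ 1ℚ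
inverse {x} 0<x = (1/ x) {{x≢0}} , <⇒≤ (positive⁻¹ _ {{1/pos⇒pos x {{positive 0<x}}}}) , *-inverseʳ x {{x≢0}}
  where
  x≢0 = pos⇒nonZero x {{positive 0<x}}

toℚᵘ-ι : ∀ a → toℚᵘ (ι a) ℚᵘ.≃ ℚᵘ.mkℚᵘ (ℤ.+ a) 0
toℚᵘ-ι zero    = ℚᵘ.≃-refl
toℚᵘ-ι (suc a) = ℚᵘ.≃-trans (toℚᵘ-homo-+ 1ℚ (ι a)) (ℚᵘ.≃-trans (ℚᵘ.+-congʳ ℚᵘ.1ℚᵘ (toℚᵘ-ι a))
  (ℚᵘ.*≡* (cong (λ t → (ℤ.+ 1 ℤ.+ t) ℤ.* ℤ.+ 1) (ℤ.*-identityʳ (ℤ.+ a)))))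

archimedean : ∀ x → ∃ λ q → x ≤ ι q
archimedean x = ℤ.∣ ℚᵘ.↥ toℚᵘ x ∣ , toℚᵘ-cancel-≤ (ℚᵘ.≤-respʳ-≃ (ℚᵘ.≃-sym (toℚᵘ-ι _)) (bound (toℚᵘ x)))
  where
  bound : ∀ y → y ℚᵘ.≤ ℚᵘ.mkℚᵘ (ℤ.+ ℤ.∣ ℚᵘ.↥ y ∣) 0
  bound (ℚᵘ.mkℚᵘ (ℤ.+ a) k) = ℚᵘ.*≤* (subst₂ ℤ._≤_ (ℤ.pos-* a 1) (ℤ.pos-* a (suc k)) (ℤ.+≤+ (ℕ.*-monoʳ-≤ a (ℕ.s≤s ℕ.z≤n))))
  bound (ℚᵘ.mkℚᵘ ℤ.-[1+ a ] k) = ℚᵘ.*≤* (ℤ.≤-trans (ℤ.≤-reflexive (ℤ.*-identityʳ ℤ.-[1+ a ])) (ℤ.≤-trans ℤ.-≤+ (ℤ.≤-reflexive (ℤ.pos-* (suc a) (suc k)))))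

ι-cancel-≤ : ∀ {a b} → ι a ≤ ι b → a ℕ.≤ b
ι-cancel-≤ {a} {b} ιa≤ιb with a ℕ.≤? b
... | yes a≤b = a≤b
... | no  a≰b = contradiction (≤-trans (ι-mono (ℕ.≰⇒> a≰b)) ιa≤ιb) (<⇒≱′ (1+> (ι b)))
  where
  <⇒≱′ : ∀ {x y} → x < y → ¬ (y ≤ x)
  <⇒≱′ x<y y≤x = <-irrefl refl (<-≤-trans x<y y≤x)
  1+> : ∀ x → x < 1ℚ + x
  1+> x = subst (_< 1ℚ + x) (+-identityˡ x) (+-monoˡ-< x (positive⁻¹ 1ℚ))

pow : ℚ → ℕ → ℚ
pow x zero    = 1ℚ
pow x (suc k) = x * pow x k

0≤pow : ∀ {x} → 0ℚ ≤ x → ∀ k → 0ℚ ≤ pow x k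
0≤pow 0≤x zero    = 0≤1
0≤pow 0≤x (suc k) = 0≤x ⊗ 0≤pow 0≤x k

pow-mono : ∀ {x y} → 0ℚ ≤ x → x ≤ y → ∀ k → pow x k ≤ pow y k
pow-mono 0≤x x≤y zero    = ≤-refl
pow-mono 0≤x x≤y (suc k) = *-mono-≤ 0≤x (0≤pow (≤-trans 0≤x x≤y) k) x≤y (pow-mono 0≤x x≤y k)

pow-* : ∀ x y k → pow (x * y) k ≡ pow x k * pow y k
pow-* x y zero    = refl
pow-* x y (suc k) = trans (cong (λ t → x * y * t) (pow-* x y k)) (interchange x y (pow x k) (pow y k))
  where
  interchange : ∀ a b c d → a * b * (c * d) ≡ a * c * (b * d)
  interchange = solve-∀ ℚ-ring

ι-^ : ∀ a k → ι (a ^ k) ≡ pow (ι a) k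
ι-^ a zero    = refl
ι-^ a (suc k) = trans (ι-* a (a ^ k)) (cong (λ t → ι a * t) (ι-^ a k))

-- One of the three nonnegative summands is at least 1, since the product of all three is.
-- This weak form of the AM-GM inequality costs only a constant.
one-large : ∀ {λ′ μ r r′ h h′} → 0ℚ ≤ λ′ → 0ℚ ≤ μ → λ′ * μ ≡ 1ℚ → 0ℚ ≤ r → 0ℚ ≤ r′ → 0ℚ ≤ h → 0ℚ ≤ h′ →
        1ℚ ≤ ℤ.+ 12 / 1 * (r * h) → 1ℚ ≤ ℤ.+ 12 / 1 * (r′ * h′) →
        1ℚ ≤ λ′ * r + λ′ * r′ + (ℤ.+ 12 / 1 * μ) * (ℤ.+ 12 / 1 * μ) * (h * h′)
one-large {λ′} {μ} {r} {r′} {h} {h′} 0≤λ 0≤μ λμ≡1 0≤r 0≤r′ 0≤h 0≤h′ rh r′h′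
  with ≤-total 1ℚ (λ′ * r) | ≤-total 1ℚ (λ′ * r′)
... | inj₁ big | _ = ≤-trans big (0≤⇒≤ (0≤λ ⊗ 0≤r′ ⊕ rest) (drop (λ′ * r) (λ′ * r′) _))
  where
  rest = (nonNegative⁻¹ (ℤ.+ 12 / 1) ⊗ 0≤μ) ⊗ (nonNegative⁻¹ (ℤ.+ 12 / 1) ⊗ 0≤μ) ⊗ (0≤h ⊗ 0≤h′)
  drop : ∀ a b c → a + b + c - a ≡ b + c
  drop = solve-∀ ℚ-ring
... | inj₂ _ | inj₁ big = ≤-trans big (0≤⇒≤ (0≤λ ⊗ 0≤r ⊕ rest) (drop (λ′ * r) (λ′ * r′) _))
  where
  rest = (nonNegative⁻¹ (ℤ.+ 12 / 1) ⊗ 0≤μ) ⊗ (nonNegative⁻¹ (ℤ.+ 12 / 1) ⊗ 0≤μ) ⊗ (0≤h ⊗ 0≤h′)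
  drop : ∀ a b c → a + b + c - b ≡ a + c
  drop = solve-∀ ℚ-ring
... | inj₂ r-small | inj₂ r′-small = ≤-trans (*-mono-≤ 0≤1 (≤-trans 0≤1 (scaled 0≤h′ r′h′ r′-small)) (scaled 0≤h rh r-small) (scaled 0≤h′ r′h′ r′-small))
    (0≤⇒≤ (0≤λ ⊗ 0≤r ⊕ 0≤λ ⊗ 0≤r′) (drop (λ′ * r) (λ′ * r′) (ℤ.+ 12 / 1 * μ) h h′))
  where
  drop : ∀ a b c h h′ → a + b + c * c * (h * h′) - c * h * (c * h′) ≡ a + b
  drop = solve-∀ ℚ-ring
  scaled : ∀ {r h} → 0ℚ ≤ h → 1ℚ ≤ ℤ.+ 12 / 1 * (r * h) → λ′ * r ≤ 1ℚ → 1ℚ ≤ ℤ.+ 12 / 1 * μ * h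
  scaled {r} {h} 0≤h rh small = ≤-trans rh (subst (_≤ ℤ.+ 12 / 1 * μ * h)
      (trans (regroup λ′ μ r h) (trans (cong (λ t → t * (ℤ.+ 12 / 1 * (r * h))) λμ≡1) (*-identityˡ _)))
      (0≤⇒≤ ((nonNegative⁻¹ (ℤ.+ 12 / 1) ⊗ 0≤μ ⊗ 0≤h) ⊗ ≤⇒0≤ small) (expand λ′ μ r h)))
    where
    regroup : ∀ l m r h → ℤ.+ 12 / 1 * m * h * (l * r) ≡ l * m * (ℤ.+ 12 / 1 * (r * h))
    regroup = solve-∀ ℚ-ring
    expand : ∀ l m r h → ℤ.+ 12 / 1 * m * h - ℤ.+ 12 / 1 * m * h * (l * r) ≡ ℤ.+ 12 / 1 * m * h * (1ℚ - l * r)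
    expand = solve-∀ ℚ-ring

-- Here m, d, K, H, σ stand for the order, the degree, ∑ρ, ∑_{u∼v} (ρs)_u (ρs)_v and twice the surplus.
module _ {m d K H σ δ ν C₁ C₂ : ℚ} (0≤m : 0ℚ ≤ m) (0≤d : 0ℚ ≤ d) (0≤K : 0ℚ ≤ K) (0≤σ : 0ℚ ≤ σ) (0≤δ : 0ℚ ≤ δ)
         (0≤C₁ : 0ℚ ≤ C₁) (0≤C₂ : 0ℚ ≤ C₂)
         (first : δ * (d * d) * K ≤ C₁ * σ) (δ-lower : 1ℚ ≤ 4ℚ * (δ * δ * d)) (m≤3dK : m ≤ ℤ.+ 3 / 1 * d * K) where

  private
    0≤4 : 0ℚ ≤ 4ℚ
    0≤4 = nonNegative⁻¹ 4ℚ

  -- As δ d is of order √d, this says that the surplus is at least of order n √d.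
  order-degree : m * (δ * d) ≤ ℤ.+ 3 / 1 * (C₁ * σ)
  order-degree = 0≤⇒≤ (nonNegative⁻¹ (ℤ.+ 3 / 1) ⊗ ≤⇒0≤ first ⊕ 0≤δ ⊗ 0≤d ⊗ ≤⇒0≤ m≤3dK) (expand m d K σ δ C₁)
    where
    expand : ∀ m d K σ δ c → ℤ.+ 3 / 1 * (c * σ) - m * (δ * d) ≡
      ℤ.+ 3 / 1 * (c * σ - δ * (d * d) * K) + δ * d * (ℤ.+ 3 / 1 * d * K - m)
    expand = solve-∀ ℚ-ring

  m²d≤ : m * m * d ≤ ℤ.+ 36 / 1 * (C₁ * C₁) * (σ * σ)
  m²d≤ = 0≤⇒≤ (0≤m ⊗ 0≤m ⊗ 0≤d ⊗ ≤⇒0≤ δ-lower ⊕ 0≤4 ⊗ ≤⇒0≤ (*-mono-≤ (0≤m ⊗ (0≤δ ⊗ 0≤d)) (nonNegative⁻¹ (ℤ.+ 3 / 1) ⊗ (0≤C₁ ⊗ 0≤σ)) order-degree order-degree))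
      (expand m d σ δ C₁)
    where
    expand : ∀ m d σ δ c → ℤ.+ 36 / 1 * (c * c) * (σ * σ) - m * m * d ≡
      m * m * d * (4ℚ * (δ * δ * d) - 1ℚ) + 4ℚ * (ℤ.+ 3 / 1 * (c * σ) * (ℤ.+ 3 / 1 * (c * σ)) - m * (δ * d) * (m * (δ * d)))
    expand = solve-∀ ℚ-ring

  -- For bounded degree n √d is of the order of n d, so the surplus is linear in the number of
  -- edges; 120 = 10 · 4 · 3. Since m d ≥ 1, its sixth power is below its seventh.
  low-degree : 1ℚ ≤ m * d → δ ≤ 1ℚ → d ≤ ℤ.+ 10 / 1 → pow (m * d) 6 ≤ pow (ℤ.+ 120 / 1 * C₁) 7 * pow σ 7
  low-degree 1≤md δ≤1 d≤10 = ≤-trans raise (≤-trans (pow-mono (0≤m ⊗ 0≤d) md≤ 7) (≤-reflexive (pow-* (ℤ.+ 120 / 1 * C₁) σ 7)))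
    where
    raise : pow (m * d) 6 ≤ pow (m * d) 7
    raise = subst (_≤ pow (m * d) 7) (*-identityˡ (pow (m * d) 6))
      (*-mono-≤ 0≤1 (0≤pow (0≤m ⊗ 0≤d) 6) 1≤md ≤-refl)
    expand : ∀ m d σ δ c → ℤ.+ 120 / 1 * c * σ - m * d ≡
      ℤ.+ 10 / 1 * (4ℚ * (ℤ.+ 3 / 1 * (c * σ) - m * (δ * d)) + 4ℚ * (m * (δ * d) * (1ℚ - δ)) + m * (4ℚ * (δ * δ * d) - 1ℚ)) + m * (ℤ.+ 10 / 1 - d)
    expand = solve-∀ ℚ-ring
    md≤ : m * d ≤ ℤ.+ 120 / 1 * C₁ * σ
    md≤ = 0≤⇒≤ (nonNegative⁻¹ (ℤ.+ 10 / 1) ⊗ (0≤4 ⊗ ≤⇒0≤ order-degree ⊕ 0≤4 ⊗ (0≤m ⊗ (0≤δ ⊗ 0≤d) ⊗ ≤⇒0≤ δ≤1) ⊕ 0≤m ⊗ ≤⇒0≤ δ-lower) ⊕ 0≤m ⊗ ≤⇒0≤ d≤10)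
      (expand m d σ δ C₁)

  module _ (second : ν * ν * H ≤ C₂ * σ) (ν-lower : 1ℚ ≤ 4ℚ * (ν * ν * m))
           (cubic : m * m * (m * d) ≤ ℤ.+ 4608 / 1 * (K * K) * H) where

    m²d≤K²σ : m * m * d ≤ ℤ.+ 18432 / 1 * C₂ * (K * K) * σ
    m²d≤K²σ = 0≤⇒≤ (nonNegative⁻¹ (ℤ.+ 18432 / 1) ⊗ (0≤K ⊗ 0≤K) ⊗ ≤⇒0≤ second ⊕ 0≤4 ⊗ (square≥0 ν ⊗ ≤⇒0≤ cubic) ⊕ 0≤m ⊗ 0≤m ⊗ 0≤d ⊗ ≤⇒0≤ ν-lower)
      (expand m d K H σ ν C₂)
      where
      expand : ∀ m d K H σ ν c → ℤ.+ 18432 / 1 * c * (K * K) * σ - m * m * d ≡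
        ℤ.+ 18432 / 1 * (K * K) * (c * σ - ν * ν * H) + 4ℚ * (ν * ν * (ℤ.+ 4608 / 1 * (K * K) * H - m * m * (m * d))) +
        m * m * d * (4ℚ * (ν * ν * m) - 1ℚ)
      expand = solve-∀ ℚ-ring

    -- Eliminates K: the previous inequality bounds m² d by a multiple of K² σ, while the square of
    -- the first bound makes d³ K² at most of order σ².
    m²d⁴≤ : m * m * (d * d * (d * d)) ≤ 4ℚ * (ℤ.+ 18432 / 1 * C₂) * (C₁ * C₁) * (σ * σ * σ)
    m²d⁴≤ = 0≤⇒≤ (0≤m ⊗ 0≤m ⊗ (0≤d ⊗ 0≤d ⊗ (0≤d ⊗ 0≤d)) ⊗ ≤⇒0≤ δ-lower ⊕
        0≤4 ⊗ (0≤δ ⊗ 0≤δ ⊗ (0≤d ⊗ 0≤d ⊗ (0≤d ⊗ 0≤d)) ⊗ ≤⇒0≤ m²d≤K²σ) ⊕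
        0≤4 ⊗ (nonNegative⁻¹ (ℤ.+ 18432 / 1) ⊗ 0≤C₂) ⊗ 0≤σ ⊗
          ≤⇒0≤ (*-mono-≤ (0≤δ ⊗ (0≤d ⊗ 0≤d) ⊗ 0≤K) (0≤C₁ ⊗ 0≤σ) first first))
      (expand m d K σ δ C₁ (ℤ.+ 18432 / 1 * C₂))
      where
      expand : ∀ m d K σ δ c a → 4ℚ * a * (c * c) * (σ * σ * σ) - m * m * (d * d * (d * d)) ≡
        m * m * (d * d * (d * d)) * (4ℚ * (δ * δ * d) - 1ℚ) +
        4ℚ * (δ * δ * (d * d * (d * d)) * (a * (K * K) * σ - m * m * d)) +
        4ℚ * a * σ * (c * σ * (c * σ) - δ * (d * d) * K * (δ * (d * d) * K))
      expand = solve-∀ ℚ-ring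

    -- The exponents match because m² d⁴ · (m² d)² = (m d)⁶ and σ³ · (σ²)² = σ⁷.
    high-degree : pow (m * d) 6 ≤
      4ℚ * (ℤ.+ 18432 / 1 * C₂) * (C₁ * C₁) * ((ℤ.+ 36 / 1 * (C₁ * C₁)) * (ℤ.+ 36 / 1 * (C₁ * C₁))) * pow σ 7
    high-degree = subst₂ _≤_ (split m d) (collect (4ℚ * (ℤ.+ 18432 / 1 * C₂) * (C₁ * C₁)) (ℤ.+ 36 / 1 * (C₁ * C₁)) σ)
      (*-mono-≤ (0≤m ⊗ 0≤m ⊗ (0≤d ⊗ 0≤d ⊗ (0≤d ⊗ 0≤d))) (0≤36 ⊗ 0≤36) m²d⁴≤
        (*-mono-≤ (0≤m ⊗ 0≤m ⊗ 0≤d) 0≤36 m²d≤ m²d≤))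
      where
      0≤36 : 0ℚ ≤ ℤ.+ 36 / 1 * (C₁ * C₁) * (σ * σ)
      0≤36 = nonNegative⁻¹ (ℤ.+ 36 / 1) ⊗ (0≤C₁ ⊗ 0≤C₁) ⊗ (0≤σ ⊗ 0≤σ)
      split : ∀ m d → m * m * (d * d * (d * d)) * (m * m * d * (m * m * d)) ≡
        m * d * (m * d * (m * d * (m * d * (m * d * (m * d * 1ℚ)))))
      split = solve-∀ ℚ-ring
      collect : ∀ a b s → a * (s * s * s) * (b * (s * s) * (b * (s * s))) ≡
        a * (b * b) * (s * (s * (s * (s * (s * (s * (s * 1ℚ)))))))
      collect = solve-∀ ℚ-ring

-- The weight m / (4 K) is chosen so that the two terms with K make up exactly half of m d. The term
-- with H bounds the other half, and 4608 = 2 · (12 · 4)².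
cubic-bound : ∀ m d K H y z → 0ℚ ≤ H → m * z ≡ 1ℚ → 4ℚ * K * y ≡ 1ℚ →
  m * d ≤ m * y * (d * K) + m * y * (d * K) + ℤ.+ 12 / 1 * (4ℚ * K * z) * (ℤ.+ 12 / 1 * (4ℚ * K * z)) * H →
  m * m * (m * d) ≤ ℤ.+ 4608 / 1 * (K * K) * H
cubic-bound m d K H y z 0≤H mz≡1 4Ky≡1 h =
  subst (m * m * (m * d) ≤_) (trans (regroup m K H z) (trans (cong (λ t → ℤ.+ 4608 / 1 * (K * K) * H * (t * t)) mz≡1) (*-identityʳ _)))
    (*-mono-≤ (square≥0 m) 0≤ (≤-refl {m * m}) md≤)
  where
  open ≤-Reasoning
  regroup : ∀ m K H z → m * m * (ℤ.+ 4608 / 1 * (K * K) * (z * z) * H) ≡ ℤ.+ 4608 / 1 * (K * K) * H * (m * z * (m * z))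
  regroup = solve-∀ ℚ-ring
  halves : ∀ m d K H y z → m * y * (d * K) + m * y * (d * K) + ℤ.+ 12 / 1 * (4ℚ * K * z) * (ℤ.+ 12 / 1 * (4ℚ * K * z)) * H ≡
    ½ * (m * d) * (4ℚ * K * y) + ½ * (ℤ.+ 4608 / 1 * (K * K) * (z * z) * H)
  halves = solve-∀ ℚ-ring
  md≤ : m * d ≤ ℤ.+ 4608 / 1 * (K * K) * (z * z) * H
  md≤ = solved (m * d) (ℤ.+ 4608 / 1 * (K * K) * (z * z) * H)
    (subst (m * d ≤_) (trans (halves m d K H y z) (cong (λ t → ½ * (m * d) * t + ½ * (ℤ.+ 4608 / 1 * (K * K) * (z * z) * H)) 4Ky≡1)) h)
    where
    solved : ∀ x a → x ≤ ½ * x * 1ℚ + ½ * a → x ≤ a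
    solved x a h = 0≤⇒≤ (nonNegative⁻¹ 2ℚ ⊗ ≤⇒0≤ h) (expand x a)
      where
      expand : ∀ x a → a - x ≡ 2ℚ * (½ * x * 1ℚ + ½ * a - x)
      expand = solve-∀ ℚ-ring
  0≤ = nonNegative⁻¹ (ℤ.+ 4608 / 1) ⊗ square≥0 K ⊗ square≥0 z ⊗ 0≤H

-- Combination of the two bounds

invSqrtℕ : ∀ {k} → 1 ℕ.≤ k → InvSqrt (ι k)
invSqrtℕ {suc k} _ = invSqrt k

-- `C₁` is 8 / (32 ε²) at ε = 1/4096, and `C₂` results from inserting the first bound into the
-- second.
C₁ C₂ : ℚ
C₁ = ℤ.+ 4194304 / 1
C₂ = ℤ.+ 64 / 1 + 32ℚ * C₁

0≤C₁ : 0ℚ ≤ C₁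
0≤C₁ = nonNegative⁻¹ C₁

0≤C₂ : 0ℚ ≤ C₂
0≤C₂ = nonNegative⁻¹ (ℤ.+ 64 / 1) ⊕ nonNegative⁻¹ 32ℚ ⊗ 0≤C₁

C-low C-high : ℚ
C-low  = pow (ℤ.+ 120 / 1 * C₁) 7
C-high = 4ℚ * (ℤ.+ 18432 / 1 * C₂) * (C₁ * C₁) * ((ℤ.+ 36 / 1 * (C₁ * C₁)) * (ℤ.+ 36 / 1 * (C₁ * C₁)))

0≤low : 0ℚ ≤ C-low
0≤low = 0≤pow (nonNegative⁻¹ (ℤ.+ 120 / 1) ⊗ 0≤C₁) 7
0≤high : 0ℚ ≤ C-high
0≤high = nonNegative⁻¹ 4ℚ ⊗ (nonNegative⁻¹ (ℤ.+ 18432 / 1) ⊗ 0≤C₂) ⊗ (0≤C₁ ⊗ 0≤C₁) ⊗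
  ((nonNegative⁻¹ (ℤ.+ 36 / 1) ⊗ (0≤C₁ ⊗ 0≤C₁)) ⊗ (nonNegative⁻¹ (ℤ.+ 36 / 1) ⊗ (0≤C₁ ⊗ 0≤C₁)))

module Surplus (G : Graph) (C5-free : C5Free G) (d : ℕ) (regular : ∀ v → deg G v ≡ d)
               (1≤d : 1 ℕ.≤ d) (1≤n : 1 ℕ.≤ n G) where

  open C5FreeRegular G C5-free d regular

  1≤D : 1ℚ ≤ D
  1≤D = ι-mono 1≤d

  1≤∣V∣ : 1ℚ ≤ ∣V∣
  1≤∣V∣ = ι-mono 1≤n

  -- Adding the degree to |N₂(v)| keeps ρ below 2δ; it costs a constant, as |N₂(v)| ≥ d/2 for d ≥ 10.
  sqrtS : ∀ v → InvSqrt (size v + D)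
  sqrtS v = subst InvSqrt (trans (ι-+ (proj₁ counted) d) (cong (λ t → t + D) (sym (proj₂ counted))))
                  (invSqrtℕ (ℕ.≤-trans 1≤d (ℕ.m≤n+m d (proj₁ counted))))
    where counted = sum-𝟙-ℕ (second v)

  sqrtD : InvSqrt D
  sqrtD = invSqrtℕ 1≤d

  sqrtn : InvSqrt ∣V∣
  sqrtn = invSqrtℕ 1≤n

  open Bounds G C5-free d regular 1≤D sqrtD sqrtS
  open SecondBound G C5-free d regular 1≤D sqrtD sqrtS sqrtn

  0≤K : 0ℚ ≤ K
  0≤K = sum-nonneg 0≤ρ

  0≤σ : 0ℚ ≤ σ
  0≤σ = ι-nonneg (2 ℕ.* mc G ∸ e G)

  0≤h : ∀ v → 0ℚ ≤ h v
  0≤h v = 0≤ρ v ⊗ 0≤size v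

  0≤H : 0ℚ ≤ H
  0≤H = sum-nonneg λ u → sum-nonneg λ v → 0≤E u v ⊗ (0≤h u ⊗ 0≤h v)

  -- Each vertex contributes at least 1 to 3 d ρ: from |N₂(v)| + d ≤ 2 d² follows 1 ≤ 8 d² ρ², and 8
  -- is rounded up to the square 9.
  ∣V∣≤3DK : ∣V∣ ≤ ℤ.+ 3 / 1 * D * K
  ∣V∣≤3DK = subst₂ _≤_ (trans (sum-const (n G) 1ℚ) (*-identityʳ ∣V∣)) (sum-const-* (ℤ.+ 3 / 1 * D) ρ)
    (sum-mono λ v → square-cancel-≤ (nonNegative⁻¹ (ℤ.+ 3 / 1) ⊗ 0≤D ⊗ 0≤ρ v)
      (lemma (ρ v) (size v) D (InvSqrt.lower (sqrtS v)) (size≤D² v) 0≤D 1≤D))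
    where
    lemma : ∀ r s d → 1ℚ ≤ 4ℚ * (r * r * (s + d)) → s ≤ d * d → 0ℚ ≤ d → 1ℚ ≤ d →
            1ℚ * 1ℚ ≤ ℤ.+ 3 / 1 * d * r * (ℤ.+ 3 / 1 * d * r)
    lemma r s d h₁ h₂ 0≤d h₃ = 0≤⇒≤ (≤⇒0≤ h₁ ⊕ nonNegative⁻¹ 4ℚ ⊗ (square≥0 r ⊗ (≤⇒0≤ h₂ ⊕ 0≤d ⊗ ≤⇒0≤ h₃)) ⊕ square≥0 (d * r))
      (expand r s d)
      where
      expand : ∀ r s d → ℤ.+ 3 / 1 * d * r * (ℤ.+ 3 / 1 * d * r) - 1ℚ * 1ℚ ≡
        4ℚ * (r * r * (s + d)) - 1ℚ + 4ℚ * (r * r * (d * d - s + d * (d - 1ℚ))) + d * r * (d * r)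
      expand = solve-∀ ℚ-ring

  K-bound : δ * (D * D) * K ≤ C₁ * σ
  K-bound = rescale (δ * (D * D) * K) σ (first-bound)
    where
    -- Here 2²⁰ ε² = 1/16, within the allowed ⅛.
    ε : ℚ
    ε = ℤ.+ 1 / 4096
    open FirstBound ε (nonNegative⁻¹ ε) (≤ᵇ⇒≤ _)
    rescale : ∀ x s → 32ℚ * (ε * ε) * x ≤ 8ℚ * s → x ≤ ℤ.+ 4194304 / 1 * s
    rescale x s h = 0≤⇒≤ (nonNegative⁻¹ (ℤ.+ 524288 / 1) ⊗ ≤⇒0≤ h) (expand x s)
      where
      expand : ∀ x s → ℤ.+ 4194304 / 1 * s - x ≡ ℤ.+ 524288 / 1 * (8ℚ * s - 32ℚ * (ℤ.+ 1 / 4096 * (ℤ.+ 1 / 4096)) * x)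
      expand = solve-∀ ℚ-ring

  H-bound : ν * ν * H ≤ C₂ * σ
  H-bound = ≤-trans second-bound (absorb (δ * (D * D) * K) C₁ σ K-bound)
    where
    absorb : ∀ x c s → x ≤ c * s → 8ℚ * (8ℚ * s) + 32ℚ * x ≤ (ℤ.+ 64 / 1 + 32ℚ * c) * s
    absorb x c s h = 0≤⇒≤ (nonNegative⁻¹ 32ℚ ⊗ ≤⇒0≤ h) (expand x c s)
      where
      expand : ∀ x c s → (ℤ.+ 64 / 1 + 32ℚ * c) * s - (8ℚ * (8ℚ * s) + 32ℚ * x) ≡ 32ℚ * (c * s - x)
      expand = solve-∀ ℚ-ring

  -- Dividing the count of two-step walks by d gives d ≤ 5 + |N₂(v)|, and 5 ≤ d / 2 from degree 10
  -- on.
  degree≤2size : ℤ.+ 10 / 1 ≤ D → ∀ v → D ≤ 2ℚ * size v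
  degree≤2size 10≤D v = cancel D (paths v) (size v) 1≤D 0≤D 10≤D (D²≤5D+paths v) (paths≤D*size v)
    where
    cancel : ∀ d p s → 1ℚ ≤ d → 0ℚ ≤ d → ℤ.+ 10 / 1 ≤ d → d * d ≤ ℤ.+ 5 / 1 * d + p → p ≤ d * s → d ≤ 2ℚ * s
    cancel d p s 1≤d 0≤d h₁ h₂ h₃ = *-cancelˡ-≤-pos d {{positive (<-≤-trans (positive⁻¹ 1ℚ) 1≤d)}}
      (0≤⇒≤ (nonNegative⁻¹ 2ℚ ⊗ (≤⇒0≤ h₃ ⊕ ≤⇒0≤ h₂) ⊕ 0≤d ⊗ ≤⇒0≤ h₁) (expand d p s))
      where
      expand : ∀ d p s → d * (2ℚ * s) - d * d ≡ 2ℚ * (d * s - p + (ℤ.+ 5 / 1 * d + p - d * d)) + d * (d - ℤ.+ 10 / 1)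
      expand = solve-∀ ℚ-ring

  -- Now |N₂(v)| + d ≤ 3 |N₂(v)|, so the lower bound on ρ² loses only a factor 3, and 12 = 4 · 3.
  1≤12ρh : ℤ.+ 10 / 1 ≤ D → ∀ v → 1ℚ ≤ ℤ.+ 12 / 1 * (ρ v * h v)
  1≤12ρh 10≤D v = lemma (ρ v) (size v) D (InvSqrt.lower (sqrtS v)) (degree≤2size 10≤D v)
    where
    lemma : ∀ r s d → 1ℚ ≤ 4ℚ * (r * r * (s + d)) → d ≤ 2ℚ * s → 1ℚ ≤ ℤ.+ 12 / 1 * (r * (r * s))
    lemma r s d h₁ h₂ = 0≤⇒≤ (≤⇒0≤ h₁ ⊕ nonNegative⁻¹ 4ℚ ⊗ (square≥0 r ⊗ ≤⇒0≤ h₂)) (expand r s d)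
      where
      expand : ∀ r s d → ℤ.+ 12 / 1 * (r * (r * s)) - 1ℚ ≡ 4ℚ * (r * r * (s + d)) - 1ℚ + 4ℚ * (r * r * (2ℚ * s - d))
      expand = solve-∀ ℚ-ring

  0<K : 0ℚ < K
  0<K = ≰⇒> λ K≤0 → <-irrefl refl (<-≤-trans (positive⁻¹ 1ℚ) (≤-trans 1≤∣V∣ (≤-trans ∣V∣≤3DK (collapse D K 0≤D K≤0))))
    where
    collapse : ∀ d k → 0ℚ ≤ d → k ≤ 0ℚ → ℤ.+ 3 / 1 * d * k ≤ 0ℚ
    collapse d k 0≤d k≤0 = 0≤⇒≤ (nonNegative⁻¹ (ℤ.+ 3 / 1) ⊗ 0≤d ⊗ ≤⇒0≤ k≤0) (expand d k)
      where
      expand : ∀ d k → 0ℚ - ℤ.+ 3 / 1 * d * k ≡ ℤ.+ 3 / 1 * d * (0ℚ - k)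
      expand = solve-∀ ℚ-ring

  edge-average : ∀ {λ′ μ} → 0ℚ ≤ λ′ → 0ℚ ≤ μ → λ′ * μ ≡ 1ℚ → ℤ.+ 10 / 1 ≤ D →
    ∣V∣ * D ≤ λ′ * (D * K) + λ′ * (D * K) + ℤ.+ 12 / 1 * μ * (ℤ.+ 12 / 1 * μ) * H
  edge-average {λ′} {μ} 0≤λ 0≤μ λμ≡1 10≤D = begin
    ∣V∣ * D                              ≡⟨ sum-const (n G) D ⟨
    ∑[ u < n G ] D                       ≡⟨ sum-cong-≗ (λ u → trans (sym (*-identityʳ D)) (sym (∑E* u 1ℚ))) ⟩
    ∑² (λ u v → E u v * 1ℚ)              ≤⟨ ∑²-mono (λ u v → 𝟙*-mono {adj G u v} λ _ →
                                             one-large 0≤λ 0≤μ λμ≡1 (0≤ρ u) (0≤ρ v) (0≤h u) (0≤h v) (1≤12ρh 10≤D u) (1≤12ρh 10≤D v)) ⟩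
    ∑² (λ u v → E u v * (λ′ * ρ u + λ′ * ρ v + x * (h u * h v)))
      ≡⟨ ∑²-cong (λ u v → expand (E u v) λ′ (ρ u) (ρ v) x (h u * h v)) ⟩
    ∑² (λ u v → (λ′ * left u v + λ′ * right u v) + x * both u v)
      ≡⟨ ∑²-+ (λ u v → λ′ * left u v + λ′ * right u v) (λ u v → x * both u v) ⟩
    ∑² (λ u v → λ′ * left u v + λ′ * right u v) + ∑² (λ u v → x * both u v)
      ≡⟨ cong₂ _+_ (trans (∑²-+ (λ u v → λ′ * left u v) (λ u v → λ′ * right u v)) (cong₂ _+_ (∑²-* λ′ left) (∑²-* λ′ right))) (∑²-* x both) ⟩
    λ′ * ∑² left + λ′ * ∑² right + x * H
      ≡⟨ cong₂ (λ a b → λ′ * a + λ′ * b + x * H) ∑left (trans ∑right ∑left) ⟩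
    λ′ * (D * K) + λ′ * (D * K) + x * H  ∎
    where
    open ≤-Reasoning
    x : ℚ
    x = ℤ.+ 12 / 1 * μ * (ℤ.+ 12 / 1 * μ)
    left right both : V → V → ℚ
    left  u v = E u v * ρ u
    right u v = E u v * ρ v
    both  u v = E u v * (h u * h v)
    expand : ∀ e l r r′ x h → e * (l * r + l * r′ + x * h) ≡ (l * (e * r) + l * (e * r′)) + x * (e * h)
    expand = solve-∀ ℚ-ring
    ∑left : ∑² left ≡ D * K
    ∑left = trans (sum-cong-≗ (λ u → ∑E* u (ρ u))) (sum-const-* D ρ)
    ∑right : ∑² right ≡ ∑² left
    ∑right = trans (∑-comm right) (∑²-cong (λ u v → cong (λ t → t * ρ u) (E-sym v u)))

  cubic : ℤ.+ 10 / 1 ≤ D → ∣V∣ * ∣V∣ * (∣V∣ * D) ≤ ℤ.+ 4608 / 1 * (K * K) * H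
  cubic 10≤D = cubic-bound ∣V∣ D K H y z 0≤H Vz≡1 Ky≡1
    (edge-average (ι-nonneg (n G) ⊗ 0≤y) (nonNegative⁻¹ 4ℚ ⊗ 0≤K ⊗ 0≤z)
      (trans (regroup ∣V∣ y K z) (cong₂ _*_ Vz≡1 Ky≡1)) 10≤D)
    where
    inverse-K = inverse {4ℚ * K} (positive⁻¹ (4ℚ * K) {{pos*pos⇒pos 4ℚ K {{positive 0<K}}}})
    inverse-V = inverse {∣V∣} (<-≤-trans (positive⁻¹ 1ℚ) 1≤∣V∣)
    y z : ℚ
    y = proj₁ inverse-K
    z = proj₁ inverse-V
    0≤y = proj₁ (proj₂ inverse-K)
    0≤z = proj₁ (proj₂ inverse-V)
    Ky≡1 = proj₂ (proj₂ inverse-K)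
    Vz≡1 = proj₂ (proj₂ inverse-V)
    regroup : ∀ v y k z → v * y * (4ℚ * k * z) ≡ v * z * (4ℚ * k * y)
    regroup = solve-∀ ℚ-ring

  surplus-bound : pow (∣V∣ * D) 6 ≤ (C-low + C-high) * pow σ 7
  surplus-bound = [ (λ D≤10 → ≤-trans (low-degree {H = H} {ν = ν} 0≤V 0≤D 0≤K 0≤σ 0≤δ 0≤C₁ 0≤C₂ K-bound δ-lower ∣V∣≤3DK 1≤VD δ≤1 D≤10)
      (*-mono-≤ 0≤low 0≤σ⁷ (subst (_≤ C-low + C-high) (+-identityʳ C-low) (+-monoʳ-≤ C-low 0≤high)) ≤-refl))
    , (λ 10≤D → ≤-trans (high-degree {ν = ν} 0≤V 0≤D 0≤K 0≤σ 0≤δ 0≤C₁ 0≤C₂ K-bound δ-lower ∣V∣≤3DK H-bound (InvSqrt.lower sqrtn) (cubic 10≤D))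
      (*-mono-≤ 0≤high 0≤σ⁷ (subst (_≤ C-low + C-high) (+-identityˡ C-high) (+-monoˡ-≤ C-high 0≤low)) ≤-refl))
    ]′ (≤-total D (ℤ.+ 10 / 1))
    where
    0≤V : 0ℚ ≤ ∣V∣
    0≤V = ι-nonneg (n G)
    δ-lower : 1ℚ ≤ 4ℚ * (δ * δ * D)
    δ-lower = InvSqrt.lower sqrtD
    1≤VD : 1ℚ ≤ ∣V∣ * D
    1≤VD = *-mono-≤ 0≤1 0≤D 1≤∣V∣ 1≤D
    0≤σ⁷ : 0ℚ ≤ pow σ 7
    0≤σ⁷ = 0≤pow 0≤σ 7

-- From the rational inequality to natural numbers

degree-sum : ∀ G d → (∀ v → deg G v ≡ d) → ι (e G) + ι (e G) ≡ ι (n G) * ι d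
degree-sum G d regular = trans (2e≡∑A G) (trans (sum-cong-≗ row) (sum-const (n G) (ι d)))
  where
  row : ∀ v → ∑[ u < n G ] A G v u ≡ ι d
  row v = trans (sym (trans (ι-sum (λ u → if adj G v u then 1 else 0)) (sum-cong-≗ (λ u → ι-if (adj G v u))))) (cong ι (regular v))

surplus-power : ∀ G d → (∀ v → deg G v ≡ d) → C5Free G → pow (ι (n G) * ι d) 6 ≤ (C-low + C-high) * pow (surplus G) 7
-- Degree or order zero makes the left side vanish; otherwise both are at least 1, as the inverse
-- roots require.
surplus-power G d regular C5-free = by-size d (n G) refl refl
  where
  empty : ∀ x → x ≡ 0ℚ → pow x 6 ≤ (C-low + C-high) * pow (surplus G) 7
  empty x refl = (0≤low ⊕ 0≤high) ⊗ 0≤pow (ι-nonneg (2 ℕ.* mc G ∸ e G)) 7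
  by-size : ∀ a b → a ≡ d → b ≡ n G → pow (ι (n G) * ι d) 6 ≤ (C-low + C-high) * pow (surplus G) 7
  by-size zero    _       0≡d _   = empty (ι (n G) * ι d) (trans (cong (λ t → ι (n G) * ι t) (sym 0≡d)) (*-zeroʳ (ι (n G))))
  by-size (suc _) zero    _   0≡n = empty (ι (n G) * ι d) (trans (cong (λ t → ι t * ι d) (sym 0≡n)) (*-zeroˡ (ι d)))
  by-size (suc _) (suc _) a≡d b≡n = Surplus.surplus-bound G C5-free d regular
    (subst (1 ℕ.≤_) a≡d (ℕ.s≤s ℕ.z≤n)) (subst (1 ℕ.≤_) b≡n (ℕ.s≤s ℕ.z≤n))

integral-constant : ∀ C → 0ℚ ≤ C → ∃ λ q → NonZero q × 2ℚ * C ≤ pow (ι q) 7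
integral-constant C 0≤C = suc q , _ , ≤-trans (proj₂ (archimedean (2ℚ * C)))
    (≤-trans (ι-mono (ℕ.n≤1+n q)) (subst (_≤ pow (ι (suc q)) 7) (*-identityʳ (ι (suc q)))
      (*-mono-≤ (ι-nonneg (suc q)) (0≤pow (ι-nonneg (suc q)) 6) ≤-refl (pow-mono 0≤1 1≤q 6))))
  where
  q : ℕ
  q = proj₁ (archimedean (2ℚ * C))
  1≤q : 1ℚ ≤ ι (suc q)
  1≤q = ι-mono {1} {suc q} (ℕ.s≤s ℕ.z≤n)

-- Since 2⁷ e⁶ = 2 (2 e)⁶ and 2 e is order times degree, the only loss is the factor 2 put in front
-- of C.
integral-bound : ∀ {C} q → 0ℚ ≤ C → 2ℚ * C ≤ pow (ι q) 7 → ∀ e s →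
  pow (ι e + ι e) 6 ≤ C * pow (ι s) 7 → (2 ℕ.* 1) ^ 7 ℕ.* e ^ 6 ℕ.≤ (q ℕ.* s) ^ 7
integral-bound {C} q 0≤C 2C≤q⁷ e s bound = ι-cancel-≤ (begin
  ι ((2 ℕ.* 1) ^ 7 ℕ.* e ^ 6)        ≡⟨ ι-* ((2 ℕ.* 1) ^ 7) (e ^ 6) ⟩
  ι ((2 ℕ.* 1) ^ 7) * ι (e ^ 6)      ≡⟨ cong (λ t → ι ((2 ℕ.* 1) ^ 7) * t) (ι-^ e 6) ⟩
  ℤ.+ 128 / 1 * pow (ι e) 6          ≡⟨ double (ι e) ⟩
  2ℚ * pow (ι e + ι e) 6
    ≤⟨ *-mono-≤ (nonNegative⁻¹ 2ℚ) (0≤C ⊗ 0≤pow (ι-nonneg s) 7) ≤-refl bound ⟩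
  2ℚ * (C * pow (ι s) 7)             ≡⟨ *-assoc 2ℚ C (pow (ι s) 7) ⟨
  2ℚ * C * pow (ι s) 7
    ≤⟨ *-mono-≤ (nonNegative⁻¹ 2ℚ ⊗ 0≤C) (0≤pow (ι-nonneg s) 7) 2C≤q⁷ ≤-refl ⟩
  pow (ι q) 7 * pow (ι s) 7          ≡⟨ pow-* (ι q) (ι s) 7 ⟨
  pow (ι q * ι s) 7                  ≡⟨ cong (λ t → pow t 7) (ι-* q s) ⟨
  pow (ι (q ℕ.* s)) 7                ≡⟨ ι-^ (q ℕ.* s) 7 ⟨
  ι ((q ℕ.* s) ^ 7)                  ∎)
  where
  open ≤-Reasoning
  double : ∀ x → ℤ.+ 128 / 1 * (x * (x * (x * (x * (x * (x * 1ℚ)))))) ≡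
    2ℚ * ((x + x) * ((x + x) * ((x + x) * ((x + x) * ((x + x) * ((x + x) * 1ℚ))))))
  double = solve-∀ ℚ-ring

-- The constant c is p/q. Writing sp as s/2, where s is the truncated difference, the seventh power
-- of c e^{6/7} ≤ s/2 becomes (2 p)⁷ e⁶ ≤ (q s)⁷ after clearing denominators.
explicit-constants : ∀ {C} → 0ℚ ≤ C →
  (∀ G d → (∀ v → deg G v ≡ d) → C5Free G → pow (ι (n G) * ι d) 6 ≤ C * pow (surplus G) 7) →
  Σ ℕ λ p → Σ ℕ λ q → NonZero p × NonZero q ×
    ((G : Graph) → Regular G → C5Free G → (2 ℕ.* p) ^ 7 ℕ.* e G ^ 6 ℕ.≤ (q ℕ.* (2 ℕ.* mc G ∸ e G)) ^ 7)
explicit-constants {C} 0≤C bound = 1 , proj₁ constant , _ , proj₁ (proj₂ constant) , λ G regular C5-free →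
  integral-bound (proj₁ constant) 0≤C (proj₂ (proj₂ constant)) (e G) (2 ℕ.* mc G ∸ e G)
    (subst (λ t → pow t 6 ≤ C * pow (surplus G) 7) (sym (degree-sum G (proj₁ regular) (proj₂ regular)))
      (bound G (proj₁ regular) (proj₂ regular) C5-free))
  where
  constant = integral-constant C 0≤C

theorem2p8 : Σ ℕ λ p → Σ ℕ λ q → NonZero p × NonZero q ×
    ((G : Graph) → Regular G → C5Free G →
    (2 ℕ.* p) ^ 7 ℕ.* e G ^ 6 ℕ.≤ (q ℕ.* (2 ℕ.* mc G ∸ e G)) ^ 7)
theorem2p8 = explicit-constants (0≤low ⊕ 0≤high) surplus-power
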